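{- There is a fixed finite groupoid $G$ such that $\mathrm{LOGCFL}\subseteq Q_G\mathrm{FO}$.
   Context: Words over a finite ordered alphabet are viewed as finite structures with universe $\{1,\dots,n\}$, unary letter predicates $P_a$, linear order $<$, equality, constants min, max; FO denotes first-order logic over this signature (without BIT). Lindström quantifier: for a language $L$ over an ordered alphabet $(b_1,\dots,b_t)$, a $k$-tuple of variables $\bar x$ and formulas $\phi_1,\dots,\phi_{t-1}$, $Q_L\bar x[\phi_1,\dots,\phi_{t-1}]$ holds on a word $w$ of length $n$ iff the word of length $n^k$ whose $i$th letter (tuples $X_1,\dots,X_{n^k}$ in lexicographic order) is $b_j$ for the least $j$ with $w\models\phi_j(X_i)$, and $b_t$ if none, belongs to $L$ ($k$ arbitrary). A groupoid is a finite set $G$ with an arbitrary binary operation; for $S\subseteq G$, $\mathcal W(S,G)$ is the set of nonempty words over alphabet $G$ that evaluate to an element of $S$ under some legal bracketing. $Q_G\mathrm{FO}$ is the class of languages definable by applying a single quantifier $Q_L$ with $L=\mathcal W(S,G)$, $S\subseteq G$, to a tuple of FO formulas. LOGCFL is the class of languages logspace many-one reducible to a context-free language. -}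

module Defs where

open import Data.Nat using (ℕ; zero; suc; _+_; _*_; _∸_; _^_; _≤_; _<ᵇ_; _≤ᵇ_)
open import Data.Nat.Logarithm using (⌊log₂_⌋)
open import Data.Fin using (Fin; zero; suc; toℕ; fromℕ; inject₁; _≟_)
open import Data.Fin.Subset using (Subset) renaming (_∈_ to _∈ₛ_)
open import Data.Vec using (Vec; lookup; fromList)
open import Data.List using (List; []; _∷_; _++_; [_]; length; map; concatMap; allFin)
open import Data.List.Membership.Propositional renaming (_∈_ to _∈ₗ_)
open import Data.Bool using (Bool; true; false; not; _∧_; _∨_; if_then_else_)
open import Data.Maybe using (Maybe; just; nothing)
open import Data.Product using (Σ; Σ-syntax; ∃; ∃-syntax; _×_; _,_)
open import Data.Sum using (_⊎_; inj₁; inj₂)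
open import Relation.Nullary.Decidable using (⌊_⌋)
open import Relation.Binary.PropositionalEquality using (_≡_)
open import Function.Bundles using (_⇔_)

Word : ℕ → Set
Word s = List (Fin s)

Language : ℕ → Set₁
Language s = Word s → Set

data Term (v : ℕ) : Set where
  var : Fin v → Term v
  tmin : Term v
  tmax : Term v

data Formula (s : ℕ) : ℕ → Set where
  P      : ∀ {v} → Fin s → Term v → Formula s v
  _⋖_    : ∀ {v} → Term v → Term v → Formula s v
  _≐_    : ∀ {v} → Term v → Term v → Formula s v
  ¬'     : ∀ {v} → Formula s v → Formula s v
  _∧'_   : ∀ {v} → Formula s v → Formula s v → Formula s v
  _∨'_   : ∀ {v} → Formula s v → Formula s v → Formula s v
  ∃'     : ∀ {v} → Formula s (suc v) → Formula s v
  ∀'     : ∀ {v} → Formula s (suc v) → Formula s v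

extend : ∀ {v} {A : Set} → A → (Fin v → A) → Fin (suc v) → A
extend a ρ zero    = a
extend a ρ (suc i) = ρ i

anyL : {A : Set} → (A → Bool) → List A → Bool
anyL p []       = false
anyL p (x ∷ xs) = p x ∨ anyL p xs

allL : {A : Set} → (A → Bool) → List A → Bool
allL p []       = true
allL p (x ∷ xs) = p x ∧ allL p xs

-- Semantics on a nonempty word of length suc n: universe = positions
-- Fin (suc n) (position i stands for i+1), min = first, max = last.
evalT : ∀ {n v} → (Fin v → Fin (suc n)) → Term v → Fin (suc n)
evalT ρ (var i) = ρ i
evalT ρ tmin    = zero
evalT {n} ρ tmax = fromℕ n

sat : ∀ {s n v} → Vec (Fin s) (suc n) → (Fin v → Fin (suc n)) → Formula s v → Bool
sat w ρ (P a t)   = ⌊ lookup w (evalT ρ t) ≟ a ⌋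
sat w ρ (t ⋖ u)   = toℕ (evalT ρ t) <ᵇ toℕ (evalT ρ u)
sat w ρ (t ≐ u)   = ⌊ evalT ρ t ≟ evalT ρ u ⌋
sat w ρ (¬' φ)    = not (sat w ρ φ)
sat w ρ (φ ∧' ψ)  = sat w ρ φ ∧ sat w ρ ψ
sat w ρ (φ ∨' ψ)  = sat w ρ φ ∨ sat w ρ ψ
sat {n = n} w ρ (∃' φ) = anyL (λ a → sat w (extend a ρ) φ) (allFin (suc n))
sat {n = n} w ρ (∀' φ) = allL (λ a → sat w (extend a ρ) φ) (allFin (suc n))

-- All k-tuples over Fin n, in lexicographic order (first coordinate
-- most significant); there are n^k of them.
tuples : (n k : ℕ) → List (Fin k → Fin n)
tuples n zero    = (λ ()) ∷ []
tuples n (suc k) = concatMap (λ i → map (λ X → extend i X) (tuples n k)) (allFin n)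

-- Alphabet (b_1,…,b_t) = Fin (suc m) in its natural order, t = suc m.
-- The letter of tuple X: b_j for the least j with w ⊨ φ_j(X), else b_t.
letterOf : ∀ {s n k m} → Vec (Fin s) (suc n) → (Fin m → Formula s k)
         → (Fin k → Fin (suc n)) → Fin (suc m)
letterOf {m = zero}  w φ X = zero
letterOf {m = suc m} w φ X =
  if sat w X (φ zero) then zero else suc (letterOf w (λ j → φ (suc j)) X)

QHolds : ∀ {s k m} → (List (Fin (suc m)) → Set) → (Fin m → Formula s k)
       → (n : ℕ) → Vec (Fin s) (suc n) → Set
QHolds {k = k} L φ n w = L (map (letterOf w φ) (tuples (suc n) k))

Groupoid : ℕ → Set
Groupoid m = Fin (suc m) → Fin (suc m) → Fin (suc m)

data Evaluates {m : ℕ} (G : Groupoid m) : List (Fin (suc m)) → Fin (suc m) → Set where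
  single : ∀ a → Evaluates G (a ∷ []) a
  split  : ∀ {u v a b} → Evaluates G u a → Evaluates G v b
         → Evaluates G (u ++ v) (G a b)

WordProblem : ∀ {m} → Groupoid m → Subset (suc m) → List (Fin (suc m)) → Set
WordProblem G S u = ∃[ g ] (Evaluates G u g × g ∈ₛ S)

-- L ∈ Q_G FO (compared on nonempty words, the universe of a structure
-- being {1,…,n} with n ≥ 1).
InQGFO : ∀ {m} → Groupoid m → ∀ {s} → Language s → Set
InQGFO {m} G {s} L =
  Σ[ S ∈ Subset (suc m) ] Σ[ k ∈ ℕ ] Σ[ φ ∈ (Fin m → Formula s k) ]
    (∀ (a : Fin s) (w : Word s) →
       L (a ∷ w) ⇔ QHolds (WordProblem G S) φ (length w) (fromList (a ∷ w)))

record CFG (d : ℕ) : Set where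
  field
    N      : ℕ
    start  : Fin N
    rules  : List (Fin N × List (Fin N ⊎ Fin d))

module _ {d : ℕ} (Γ : CFG d) where
  open CFG Γ
  mutual
    data Derives : Fin N → Word d → Set where
      rule : ∀ {A rhs u} → (A , rhs) ∈ₗ rules → DerivesSeq rhs u → Derives A u
    data DerivesSeq : List (Fin N ⊎ Fin d) → Word d → Set where
      nil  : DerivesSeq [] []
      term : ∀ {a r u} → DerivesSeq r u → DerivesSeq (inj₂ a ∷ r) (a ∷ u)
      nont : ∀ {B r u v} → Derives B u → DerivesSeq r v → DerivesSeq (inj₁ B ∷ r) (u ++ v)

  LangCFG : Language d
  LangCFG u = Derives start u

-- Deterministic logspace transducers: read-only input tape with
-- endmarkers, one work tape, write-only (append-only) output tape.

data InSym (s : ℕ) : Set where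
  lend rend : InSym s
  letter    : Fin s → InSym s

data Move : Set where
  left stay right : Move

record Action (Q γ d : ℕ) : Set where
  field
    next    : Fin Q
    inMove  : Move
    write   : Fin γ
    wMove   : Move
    emit    : Maybe (Fin d)

record Transducer (s d : ℕ) : Set where
  field
    Q      : ℕ
    γ      : ℕ                       -- work alphabet Fin (suc γ), blank = zero
    q₀     : Fin Q
    δ      : Fin Q → InSym s → Fin (suc γ) → Maybe (Action Q (suc γ) d)
                                     -- nothing = halt

record Config {s d : ℕ} (M : Transducer s d) : Set where
  field
    state : Fin (Transducer.Q M)
    ipos  : ℕ                        -- 0 = left endmarker, n+1 = right endmarker
    tape  : ℕ → Fin (suc (Transducer.γ M))
    wpos  : ℕ
    out   : List (Fin d)

readAt : ∀ {s} → Word s → ℕ → InSym s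
readAt w zero                 = lend
readAt [] (suc _)             = rend
readAt (x ∷ xs) (suc zero)    = letter x
readAt (x ∷ xs) (suc (suc j)) = readAt xs (suc j)

-- head moves; the input head stays within 0 … n+1, heads cannot move left of 0
moveIn : ℕ → Move → ℕ → ℕ
moveIn n left  i = i ∸ 1
moveIn n stay  i = i
moveIn n right i = if i ≤ᵇ n then suc i else i

moveW : Move → ℕ → ℕ
moveW left  j = j ∸ 1
moveW stay  j = j
moveW right j = suc j

emitTo : ∀ {d} → List (Fin d) → Maybe (Fin d) → List (Fin d)
emitTo o nothing  = o
emitTo o (just a) = o ++ [ a ]

step : ∀ {s d} (M : Transducer s d) → Word s → Config M → Maybe (Config M)
step M w c with Transducer.δ M (Config.state c) (readAt w (Config.ipos c))
                                (Config.tape c (Config.wpos c))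
... | nothing = nothing
... | just a = just record
  { state = Action.next a
  ; ipos  = moveIn (length w) (Action.inMove a) (Config.ipos c)
  ; tape  = λ j → if j ≡ᵇ' Config.wpos c then Action.write a else Config.tape c j
  ; wpos  = moveW (Action.wMove a) (Config.wpos c)
  ; out   = emitTo (Config.out c) (Action.emit a)
  }
  where
  _≡ᵇ'_ : ℕ → ℕ → Bool
  zero  ≡ᵇ' zero  = true
  suc i ≡ᵇ' suc j = i ≡ᵇ' j
  _     ≡ᵇ' _     = false

initConfig : ∀ {s d} (M : Transducer s d) → Config M
initConfig M = record { state = Transducer.q₀ M ; ipos = 0 ; tape = λ _ → zero
                      ; wpos = 0 ; out = [] }

data RunsTo {s d} (M : Transducer s d) (w : Word s) (B : ℕ)
     : Config M → List (Fin d) → Set where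
  halt : ∀ {c} → Config.wpos c ≤ B → step M w c ≡ nothing
       → RunsTo M w B c (Config.out c)
  next : ∀ {c c' o} → Config.wpos c ≤ B → step M w c ≡ just c'
       → RunsTo M w B c' o → RunsTo M w B c o

LogspaceReducible : ∀ {s d} → Language s → Language d → Set
LogspaceReducible {s} {d} L L' =
  Σ[ M ∈ Transducer s d ] Σ[ c ∈ ℕ ] ∀ (w : Word s) →
    Σ[ o ∈ Word d ] (RunsTo M w (c * ⌊log₂ (length w) ⌋ + c) (initConfig M) o
                     × (L w ⇔ L' o))

InLOGCFL : ∀ {s} → Language s → Set
InLOGCFL {s} L = Σ[ d ∈ ℕ ] Σ[ Γ ∈ CFG d ] LogspaceReducible L (LangCFG Γ)

{-# OPTIONS --safe #-}

-- A run of a logspace transducer followed by a leftmost derivation in a grammar is a computation on a stack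
-- that holds four numbers (state, input position, tape below the head, tape from the head on, both read in a
-- base larger than the tape alphabet) above the pending sentence.  In unary, a step of this computation pops
-- a few numbers α x + β and pushes others, where x is below a fixed power of the word length: the division
-- hidden in moving the tape head is done by popping b x + d and pushing x.  Whether to emit a push or pop
-- letter at a position then only depends on comparisons of tuples, which need order but no arithmetic.
-- The word fed to the groupoid lists, polynomially many times, the blocks of all possible steps; the groupoid
-- evaluates it to one pop letter iff some choice of blocks (the others being skipped) empties the stack [ 0 ].
-- Polynomially many rounds suffice: a halting deterministic machine repeats no configuration, and a derivation
-- tree without repetitions along paths of constant yield has polynomial size.

module Submission where

open import Defs
open import Data.Nat using (ℕ)
open import Data.Product using (Σ-syntax)
open import Data.Nat using (zero; suc; _+_; _*_; _^_; _∸_; _≤_; _<_; z≤n; s≤s; _<ᵇ_; _≤ᵇ_; _≡ᵇ_; ⌊_/2⌋; ⌈_/2⌉; >-nonZero) renaming (_≟_ to _≟ℕ_)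
open import Data.Nat.Properties hiding (_≟_)
open import Data.Nat.Induction using (<-rec)
open import Data.Nat.ListAction using (sum)
open import Data.Nat.Logarithm using (⌊log₂_⌋; ⌊log₂⌋-mono-≤; ⌊log₂⌊n/2⌋⌋≡⌊log₂n⌋∸1; ⌊log₂[2^n]⌋≡n)
open import Data.Nat.Tactic.RingSolver using (solve-∀)
open import Data.Fin using (Fin; zero; suc; toℕ; fromℕ; fromℕ<; inject₁; join; splitAt; combine; _≟_)
open import Data.Fin.Properties using (any?; toℕ<n; toℕ-injective; toℕ-fromℕ; toℕ-fromℕ<; fromℕ<-injective; combine-injective; injective⇒≤; splitAt-join)
open import Data.Fin.Subset using (Subset; ⁅_⁆; _-_; _─_; ∣_∣; _⊆_; _∉_; inside; outside) renaming (⊤ to ⊤ₛ; _∈_ to _∈ₛ_)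
open import Data.Fin.Subset.Properties using (p─q⊆p; p─x─y≡p─y─x; x∈p∧x≢y⇒x∈p-y; x∈p∧x∉q⇒x∈p─q; x∈p⇒∣p-x∣<∣p∣; ∣p∣≤n; ⊆⊤; ∈⊤; x∈⁅x⁆; x∈⁅y⁆⇒x≡y)
open import Data.Bool using (Bool; true; false; not; if_then_else_; T)
open import Data.Bool.Properties using (∨-identityʳ)
open import Data.Maybe using (Maybe; just; nothing; maybe) renaming (map to mapᵐ)
open import Data.Maybe.Properties using (just-injective)
open import Data.Vec using (Vec; []; _∷_; here; there; fromList) renaming (lookup to lookupᵛ; map to mapᵛ; tabulate to tabulateᵛ; take to takeᵛ; drop to dropᵛ)
open import Data.Vec.Properties using (take-map; drop-map; lookup-map) renaming (tabulate-∘ to tabulateᵛ-∘)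
open import Data.List using (List; []; _∷_; _++_; [_]; length; map; concat; concatMap; tabulate; allFin; replicate; take; drop)
open import Data.List.Properties using (++-assoc; ++-identityʳ; ∷-injective; ∷-injectiveˡ; ∷-injectiveʳ; length-++; length-take; length-drop; take++drop≡id; map-++; map-cong; map-tabulate; map-concatMap; tabulate-cong; concatMap-++) renaming (map-∘ to map-∘ˡ)
open import Data.List.Relation.Unary.All using (All; []; _∷_) renaming (map to All-map; lookup to All-lookup; tabulate to All-tabulate)
open import Data.List.Relation.Unary.All.Properties using () renaming (++⁺ to All-++⁺; map⁺ to All-map⁺; replicate⁺ to All-replicate⁺)
open import Data.List.Relation.Unary.Any using (here; there) renaming (map to Any-map)
open import Data.List.Membership.Propositional using (_∈_)
open import Data.List.Membership.Propositional.Properties using (∈-++⁺ˡ; ∈-++⁺ʳ; ∈-concatMap⁺; ∈-map⁺; ∈-allFin)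
open import Data.Product using (Σ; ∃-syntax; _×_; _,_; proj₁; proj₂)
open import Data.Sum using (_⊎_; inj₁; inj₂)
open import Data.Empty using (⊥; ⊥-elim)
open import Data.Unit using (⊤; tt)
open import Function using (_∘_; id; _⇔_; mk⇔; Equivalence)
open import Relation.Nullary using (yes; no; ¬_; Dec; _×-dec_)
open import Relation.Nullary.Decidable using (⌊_⌋; isYes≗does; dec-true; dec-false; map′)
open import Relation.Binary.Definitions using (tri<; tri≈; tri>)
open import Relation.Binary.PropositionalEquality hiding ([_])

-- The groupoid

-- The word offers choices among blocks over a two-symbol stack, in the manner of Greibach's hardest
-- context-free language. One groupoid serves all languages because states, tape symbols and grammar
-- symbols become numbers: machine and grammar enter only through the formulas. First-order formulas
-- without BIT cannot compute the output of the transducer, so the transducer itself runs on the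
-- stack. Its output is never stored: each emitted letter is matched at once against the pending
-- sentence. Two obstacles shape the groupoid. Acceptance ranges over all bracketings, also
-- unintended ones; soundness is therefore proved for a coarser relation, `Run`, which every
-- bracketing respects and which the block format alone tames. And an element of a finite groupoid
-- cannot hold a stack; completeness therefore assigns to a suffix of the word one factor for each
-- symbol of the stack that it empties. The neutral letter `unit` fills the positions of the
-- tuple-indexed word where nothing is to be emitted.

Letter : Set
Letter = Fin 10

pattern unit    = zero
pattern junk    = suc zero
pattern push₁   = suc (suc zero)
pattern pop₁    = suc (suc (suc zero))
pattern push#   = suc (suc (suc (suc zero)))
pattern pop#    = suc (suc (suc (suc (suc zero))))
pattern mark    = suc (suc (suc (suc (suc (suc zero)))))
pattern open'   = suc (suc (suc (suc (suc (suc (suc zero))))))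
pattern close   = suc (suc (suc (suc (suc (suc (suc (suc zero)))))))
pattern killing = suc (suc (suc (suc (suc (suc (suc (suc (suc zero))))))))

pushL popL : Bool → Letter
pushL true = push₁
pushL false = push#
popL true = pop₁
popL false = pop#

-- A block mark open' c mark close is used when both (mark open') and (mark close) evaluate to unit,
-- and skipped when open' swallows everything up to close and the result open' meets the first mark.
data Product : Letter → Letter → Letter → Set where
  idˡ         : ∀ {h} → Product unit h h
  idʳ         : ∀ {g} → Product g unit g
  cancel      : ∀ x → Product (pushL x) (popL x) unit
  mark-open   : Product mark open' unit
  mark-close  : Product mark close unit
  open-any    : ∀ {h} → Product open' h killing
  kill-close  : Product killing close open'
  kill-any    : ∀ {h} → Product killing h killing
  undefined   : ∀ {g h} → Product g h junk

product : ∀ g h → Σ Letter (Product g h)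
product unit    h     = _ , idˡ
product g       unit  = _ , idʳ
product push₁   pop₁  = _ , cancel true
product push#   pop#  = _ , cancel false
product mark    open' = _ , mark-open
product mark    close = _ , mark-close
product open'   h     = _ , open-any
product killing close = _ , kill-close
product killing h     = _ , kill-any
product g       h     = _ , undefined

𝔾 : Groupoid 9
𝔾 g h = proj₁ (product g h)

-- Soundness: an evaluation yields a run on the stack.

Stack : Set
Stack = List Bool

-- The brackets and `mark` act as the identity even where nothing cancels them, an overapproximation
-- from which block words gain nothing. `junk` and `killing` act as the empty relation.
Acts : Letter → Stack → Stack → Set
Acts junk    s t = ⊥
Acts killing s t = ⊥
Acts push₁   s t = t ≡ true ∷ s
Acts pop₁    s t = s ≡ true ∷ t
Acts push#   s t = t ≡ false ∷ s
Acts pop#    s t = s ≡ false ∷ t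
Acts _       s t = s ≡ t

Opening : Letter → Set
Opening a = a ≡ open' ⊎ a ≡ killing

-- The semantic counterpart of 𝔾: a run may jump from any opening letter past any later close.
data Run : List Letter → Stack → Stack → Set where
  done : ∀ {s} → Run [] s s
  move : ∀ {a v s m t} → Acts a s m → Run v m t → Run (a ∷ v) s t
  skip : ∀ {a v s t} x → Opening a → Run v s t → Run (a ∷ x ++ close ∷ v) s t

Run-++ : ∀ {u v s m t} → Run u s m → Run v m t → Run (u ++ v) s t
Run-++ done r′ = r′
Run-++ (move a r) r′ = move a (Run-++ r r′)
Run-++ {v = v} (skip {v = u} x o r) r′
  rewrite ++-assoc x (close ∷ u) v = skip x o (Run-++ r r′)

Neutral : List Letter → Set
Neutral v = ∀ {s} → Run v s s

Neutral-++ : ∀ {u v} → Neutral u → Neutral v → Neutral (u ++ v)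
Neutral-++ p q = Run-++ p q

-- What a value `open'`, `killing` or `close` remembers of its word for a later jump. Only the part
-- before the opening letter and the part after the `close` must be neutral; all that lies between
-- is jumped over.
Opens Closes : List Letter → Set
Opens  v = ∃[ p ] ∃[ a ] ∃[ x ] (v ≡ p ++ a ∷ x × Opening a × Neutral p)
Closes v = ∃[ x ] ∃[ q ] (v ≡ x ++ close ∷ q × Neutral q)

Shape : Letter → List Letter → Set
Shape open'   v = Opens v
Shape killing v = Opens v
Shape close   v = Closes v
Shape _       v = ⊤

-- Only one direction is kept: every effect of the value is realised by a run of the word. Undefined
-- products are then harmless, as `junk` has no effect.
Denotes : List Letter → Letter → Set
Denotes v g = (∀ {s t} → Acts g s t → Run v s t) × Shape g v

single-denotes : ∀ g → Denotes (g ∷ []) g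
single-denotes g = (λ a → move a done) , shape g
  where
  shape : ∀ g → Shape g (g ∷ [])
  shape unit = tt
  shape junk = tt
  shape push₁ = tt
  shape pop₁ = tt
  shape push# = tt
  shape pop# = tt
  shape mark = tt
  shape open' = [] , _ , _ , refl , inj₁ refl , done
  shape close = [] , [] , refl , done
  shape killing = [] , _ , _ , refl , inj₂ refl , done

Opens-++ : ∀ {u} v → Opens u → Opens (u ++ v)
Opens-++ v (p , a , x , refl , o , n) = p , a , x ++ v , ++-assoc p (a ∷ x) v , o , n

Opens-prepend : ∀ {u v} → Neutral u → Opens v → Opens (u ++ v)
Opens-prepend {u} n (p , a , x , refl , o , n′) =
  u ++ p , a , x , sym (++-assoc u p (a ∷ x)) , o , Neutral-++ n n′

Closes-prepend : ∀ u {v} → Closes v → Closes (u ++ v)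
Closes-prepend u (x , q , refl , n) = u ++ x , q , sym (++-assoc u x (close ∷ q)) , n

Closes-++ : ∀ {u v} → Neutral v → Closes u → Closes (u ++ v)
Closes-++ {v = v} n′ (x , q , refl , n) =
  x , q ++ v , ++-assoc x (close ∷ q) v , Neutral-++ n n′

Shape-prepend : ∀ h {u v} → Neutral u → Shape h v → Shape h (u ++ v)
Shape-prepend unit n _ = tt
Shape-prepend junk n _ = tt
Shape-prepend push₁ n _ = tt
Shape-prepend pop₁ n _ = tt
Shape-prepend push# n _ = tt
Shape-prepend pop# n _ = tt
Shape-prepend mark n _ = tt
Shape-prepend open' n = Opens-prepend n
Shape-prepend close {u} n = Closes-prepend u
Shape-prepend killing n = Opens-prepend n

Shape-++ : ∀ g {u v} → Neutral v → Shape g u → Shape g (u ++ v)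
Shape-++ unit n _ = tt
Shape-++ junk n _ = tt
Shape-++ push₁ n _ = tt
Shape-++ pop₁ n _ = tt
Shape-++ push# n _ = tt
Shape-++ pop# n _ = tt
Shape-++ mark n _ = tt
Shape-++ open' {v = v} n = Opens-++ v
Shape-++ close n = Closes-++ n
Shape-++ killing {v = v} n = Opens-++ v

Acts-cancel : ∀ x {s m t} → m ≡ x ∷ s → s ≡ t → Acts (pushL x) s m × Acts (popL x) m t
Acts-cancel true refl refl = refl , refl
Acts-cancel false refl refl = refl , refl

product-denotes : ∀ {g h k u v} → Product g h k → Denotes u g → Denotes v h → Denotes (u ++ v) k
product-denotes {h = h} idˡ (p , _) (q , sh) =
  (λ a → Run-++ (p refl) (q a)) , Shape-prepend h (p refl) sh
product-denotes {g} idʳ (p , sh) (q , _) =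
  (λ a → Run-++ (p a) (q refl)) , Shape-++ g (q refl) sh
product-denotes (cancel x) (p , _) (q , _) =
  (λ e → let a , b = Acts-cancel x refl e in Run-++ (p a) (q b)) , tt
product-denotes mark-open (p , _) (q , _) = (λ a → Run-++ (p a) (q refl)) , tt
product-denotes mark-close (p , _) (q , _) = (λ a → Run-++ (p a) (q refl)) , tt
product-denotes {v = v} open-any (_ , sh) _ = (λ ()) , Opens-++ v sh
product-denotes {v = v} kill-any (_ , sh) _ = (λ ()) , Opens-++ v sh
product-denotes undefined _ _ = (λ ()) , tt
-- The run crosses the neutral `p`, jumps from `a` over `x ++ y` past the `close`, and crosses the
-- neutral `q`; in total it is the identity, as the value `open'` demands.
product-denotes {v = v} kill-close (_ , sh@(p , a , x , refl , o , n)) (_ , (y , q , refl , n′)) =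
  (λ { refl → subst (λ l → Run l _ _) eq (Run-++ n (skip (x ++ y) o n′)) }) , Opens-++ v sh
  where
  eq : p ++ a ∷ (x ++ y) ++ close ∷ q ≡ (p ++ a ∷ x) ++ y ++ close ∷ q
  eq = trans (cong (λ l → p ++ a ∷ l) (++-assoc x y (close ∷ q)))
             (sym (++-assoc p (a ∷ x) (y ++ close ∷ q)))

Evaluates⇒Denotes : ∀ {v g} → Evaluates 𝔾 v g → Denotes v g
Evaluates⇒Denotes (single a) = single-denotes a
Evaluates⇒Denotes (split {a = a} {b = b} e f) =
  product-denotes (proj₂ (product a b)) (Evaluates⇒Denotes e) (Evaluates⇒Denotes f)

-- Block words: selections of blocks against runs and evaluations.

data Content : Letter → Set where
  pushing : ∀ x → Content (pushL x)
  popping : ∀ x → Content (popL x)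
  failing : Content junk

blocks : List (List Letter) → List Letter
blocks []       = []
blocks (c ∷ cs) = mark ∷ open' ∷ c ++ mark ∷ close ∷ blocks cs

blocks-++ : ∀ cs ds → blocks (cs ++ ds) ≡ blocks cs ++ blocks ds
blocks-++ [] ds = refl
blocks-++ (c ∷ cs) ds = cong (λ l → mark ∷ open' ∷ l)
  (trans (cong (λ l → c ++ mark ∷ close ∷ l) (blocks-++ cs ds))
         (sym (++-assoc c (mark ∷ close ∷ blocks cs) (blocks ds))))

data Moves : List Letter → Stack → Stack → Set where
  done : ∀ {s} → Moves [] s s
  push : ∀ {v s t} x → Moves v (x ∷ s) t → Moves (pushL x ∷ v) s t
  pop  : ∀ {v s t} x → Moves v s t → Moves (popL x ∷ v) (x ∷ s) t

data Selection : List (List Letter) → Stack → Stack → Set where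
  done : ∀ {s} → Selection [] s s
  omit : ∀ {c cs s t} → Selection cs s t → Selection (c ∷ cs) s t
  choose : ∀ {c cs s m t} → Moves c s m → Selection cs m t → Selection (c ∷ cs) s t

private
  no-open : ∀ {a} → Content a → ¬ Opening a
  no-open (pushing true) (inj₁ ())
  no-open (pushing true) (inj₂ ())
  no-open (pushing false) (inj₁ ())
  no-open (pushing false) (inj₂ ())
  no-open (popping true) (inj₁ ())
  no-open (popping true) (inj₂ ())
  no-open (popping false) (inj₁ ())
  no-open (popping false) (inj₂ ())
  no-open failing (inj₁ ())
  no-open failing (inj₂ ())

  no-close : ¬ Content close
  no-close c = lem c refl
    where
    lem : ∀ {a} → Content a → a ≢ close
    lem (pushing true) ()
    lem (pushing false) ()
    lem (popping true) ()
    lem (popping false) ()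
    lem failing ()

  -- A jump may cross several blocks. Contents are free of `close`, so it lands at the end of a
  -- block; what remains is a block word, and its selections extend by omitting the blocks crossed.
  Rest : List (List Letter) → List Letter → Set
  Rest cs v = ∃[ ds ] (v ≡ blocks ds × All (All Content) ds ×
                       (∀ {s t} → Selection ds s t → Selection cs s t))

  after-close : ∀ cs → All (All Content) cs → ∀ x {v} → x ++ close ∷ v ≡ blocks cs → Rest cs v
  after-close-in : ∀ {c cs} d → All Content d → All (All Content) cs → ∀ x {v} →
    x ++ close ∷ v ≡ d ++ mark ∷ close ∷ blocks cs → Rest (c ∷ cs) v

  after-close [] _ [] ()
  after-close [] _ (_ ∷ _) ()
  after-close (c ∷ cs) _ [] ()
  after-close (c ∷ cs) _ (_ ∷ []) ()
  after-close (c ∷ cs) (p ∷ ps) (_ ∷ _ ∷ x) eq =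
    after-close-in c p ps x (∷-injectiveʳ (∷-injectiveʳ eq))

  after-close-in {cs = cs} [] _ ps [] ()
  after-close-in {cs = cs} [] _ ps (_ ∷ []) refl = cs , refl , ps , omit
  after-close-in {cs = cs} [] _ ps (_ ∷ _ ∷ x) eq
    with after-close cs ps x (∷-injectiveʳ (∷-injectiveʳ eq))
  ... | ds , e , qs , f = ds , e , qs , λ σ → omit (f σ)
  after-close-in (_ ∷ d) (p ∷ _) ps [] eq with ∷-injectiveˡ eq
  ... | refl = ⊥-elim (no-close p)
  after-close-in (_ ∷ d) (_ ∷ p) ps (_ ∷ x) eq = after-close-in d p ps x (∷-injectiveʳ eq)

  content-moves : ∀ {a v s m t} → Content a → Acts a s m → Moves v m t → Moves (a ∷ v) s t
  content-moves (pushing true) refl m = push true m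
  content-moves (pushing false) refl m = push false m
  content-moves (popping true) refl m = pop true m
  content-moves (popping false) refl m = pop false m

-- The four statements track the place of the run: before a block, behind its first `mark`, inside
-- its content, and before its `close`. An opening letter is met only behind the first `mark`, so
-- jumps begin only there.
Run-blocks⇒Selection : ∀ {v s t} cs → All (All Content) cs →
  Run v s t → v ≡ blocks cs → Selection cs s t
Run-opened⇒Selection : ∀ {v s t} c cs → All (All Content) (c ∷ cs) →
  Run v s t → v ≡ open' ∷ c ++ mark ∷ close ∷ blocks cs → Selection (c ∷ cs) s t
Run-content⇒Selection : ∀ {v s t} c cs → All (All Content) (c ∷ cs) →
  Run v s t → v ≡ c ++ mark ∷ close ∷ blocks cs → ∃[ m ] (Moves c s m × Selection cs m t)
Run-closing⇒Selection : ∀ {v s t} cs → All (All Content) cs →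
  Run v s t → v ≡ close ∷ blocks cs → Selection cs s t

Run-blocks⇒Selection [] _ done _ = done
Run-blocks⇒Selection [] _ (move _ _) ()
Run-blocks⇒Selection [] _ (skip _ _ _) ()
Run-blocks⇒Selection (c ∷ cs) ps (move b r) refl with b
... | refl = Run-opened⇒Selection c cs ps r refl
Run-blocks⇒Selection (c ∷ cs) _ (skip x (inj₁ refl) r) ()
Run-blocks⇒Selection (c ∷ cs) _ (skip x (inj₂ refl) r) ()

Run-opened⇒Selection c cs ps (move b r) refl with b
... | refl = let m , σ , τ = Run-content⇒Selection c cs ps r refl in choose σ τ
Run-opened⇒Selection c cs (p ∷ ps) (skip x o r) eq =
  let ds , e , qs , f = after-close-in c p ps x (∷-injectiveʳ eq)
  in f (Run-blocks⇒Selection ds qs r e)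

Run-content⇒Selection [] cs (_ ∷ ps) (move b r) refl with b
... | refl = _ , done , Run-closing⇒Selection cs ps r refl
Run-content⇒Selection [] cs _ (skip _ (inj₁ refl) r) ()
Run-content⇒Selection [] cs _ (skip _ (inj₂ refl) r) ()
Run-content⇒Selection (a ∷ c) cs ((p ∷ q) ∷ ps) (move b r) refl =
  let m , σ , τ = Run-content⇒Selection c cs (q ∷ ps) r refl in m , content-moves p b σ , τ
Run-content⇒Selection (a ∷ c) cs ((p ∷ q) ∷ ps) (skip _ o r) eq with ∷-injectiveˡ eq
... | refl = ⊥-elim (no-open p o)

Run-closing⇒Selection cs ps (move b r) refl with b
... | refl = Run-blocks⇒Selection cs ps r refl
Run-closing⇒Selection cs _ (skip _ (inj₁ refl) r) ()
Run-closing⇒Selection cs _ (skip _ (inj₂ refl) r) ()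

-- v is cut into one factor per stack symbol, each reducing to the letter that pops it.
Factors : Stack → List Letter → Set
Factors []      v = v ≡ [] ⊎ Evaluates 𝔾 v unit
Factors (x ∷ s) v = ∃[ y ] ∃[ z ] (v ≡ y ++ z × Evaluates 𝔾 y (popL x) × Factors s z)

-- The first factor absorbs a prefix of value `unit`. With an empty stack there is no factor to
-- absorb it, and since the empty word has no value, `Factors []` allows both cases.
Factors-prepend : ∀ s {e v} → Evaluates 𝔾 e unit → Factors s v → Factors s (e ++ v)
Factors-prepend [] {e} p (inj₁ refl) = inj₂ (subst (λ l → Evaluates 𝔾 l unit) (sym (++-identityʳ e)) p)
Factors-prepend [] p (inj₂ q) = inj₂ (split p q)
Factors-prepend (x ∷ s) {e} p (y , z , refl , q , f) =
  e ++ y , z , sym (++-assoc e y z) , split p q , f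

-- The pushing letter cancels against the factor that pops `x`, and the resulting `unit` merges into
-- the next factor.
Factors-push : ∀ x s {v} → Factors (x ∷ s) v → Factors s (pushL x ∷ v)
Factors-push true s (y , z , refl , q , f) = Factors-prepend s (split (single push₁) q) f
Factors-push false s (y , z , refl , q , f) = Factors-prepend s (split (single push#) q) f

Factors-moves : ∀ {c s m v} → Moves c s m → Factors m v → Factors s (c ++ v)
Factors-moves done f = f
Factors-moves {s = s} (push x μ) f = Factors-push x s (Factors-moves μ f)
Factors-moves (pop x μ) f = [ popL x ] , _ , refl , single (popL x) , Factors-moves μ f

private
  kill-more : ∀ {a} → Content a → 𝔾 killing a ≡ killing × 𝔾 open' a ≡ killing
  kill-more (pushing true) = refl , refl
  kill-more (pushing false) = refl , refl
  kill-more (popping true) = refl , refl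
  kill-more (popping false) = refl , refl
  kill-more failing = refl , refl

  kills : ∀ {u c} → All Content c → Evaluates 𝔾 u killing → Evaluates 𝔾 (u ++ c ++ [ mark ]) killing
  kills [] e = split e (single mark)
  kills {u} {a ∷ c} (p ∷ ps) e =
    subst (λ l → Evaluates 𝔾 l killing) (++-assoc u [ a ] (c ++ [ mark ]))
      (kills ps (subst (Evaluates 𝔾 (u ++ [ a ])) (proj₁ (kill-more p)) (split e (single a))))

  opened : ∀ {c} → All Content c → Evaluates 𝔾 (open' ∷ c ++ [ mark ]) killing
  opened [] = split (single open') (single mark)
  opened {a ∷ c} (p ∷ ps) =
    kills ps (subst (Evaluates 𝔾 (open' ∷ [ a ])) (proj₂ (kill-more p)) (split (single open') (single a)))

  skipped : ∀ {c} → All Content c → Evaluates 𝔾 (mark ∷ open' ∷ c ++ mark ∷ [ close ]) unit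
  skipped {c} p = split (single mark)
    (subst (λ l → Evaluates 𝔾 (open' ∷ l) open') (++-assoc c [ mark ] [ close ])
      (split (opened p) (single close)))

Selection⇒Factors : ∀ {cs s} → All (All Content) cs → Selection cs s [] → Factors s (blocks cs)
Selection⇒Factors _ done = inj₁ refl
Selection⇒Factors {c ∷ cs} {s} (p ∷ ps) (omit σ) =
  subst (λ l → Factors s (mark ∷ open' ∷ l)) (++-assoc c (mark ∷ [ close ]) (blocks cs))
    (Factors-prepend s (skipped p) (Selection⇒Factors ps σ))
Selection⇒Factors {s = s} (_ ∷ ps) (choose {m = m} μ σ) =
  Factors-prepend s (split (single mark) (single open'))
    (Factors-moves μ
      (Factors-prepend m (split (single mark) (single close)) (Selection⇒Factors ps σ)))

-- `[ false ]` encodes the stack `[ 0 ]`. Starting from the empty stack instead would accept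
-- everything, by omitting all blocks.
Selection⇒Evaluates : ∀ {cs} → All (All Content) cs →
  Selection cs [ false ] [] → Evaluates 𝔾 (blocks cs) pop#
Selection⇒Evaluates ps σ with Selection⇒Factors ps σ
... | y , _ , eq , e , inj₁ refl = subst (λ l → Evaluates 𝔾 l pop#) (trans (sym (++-identityʳ y)) (sym eq)) e
... | y , _ , eq , e , inj₂ f = subst (λ l → Evaluates 𝔾 l pop#) (sym eq) (split e f)

-- Words described by tuples of digits

𝔾-identityʳ : ∀ g → 𝔾 g unit ≡ g
𝔾-identityʳ unit = refl
𝔾-identityʳ junk = refl
𝔾-identityʳ push₁ = refl
𝔾-identityʳ pop₁ = refl
𝔾-identityʳ push# = refl
𝔾-identityʳ pop# = refl
𝔾-identityʳ mark = refl
𝔾-identityʳ open' = refl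
𝔾-identityʳ close = refl
𝔾-identityʳ killing = refl

++-cut : ∀ {A : Set} (p : List A) {q} u {v} → p ++ q ≡ u ++ v →
         (∃[ r ] (u ≡ p ++ r × q ≡ r ++ v)) ⊎ (∃[ r ] (p ≡ u ++ r × v ≡ r ++ q))
++-cut [] u eq = inj₁ (u , refl , eq)
++-cut (x ∷ p) [] eq = inj₂ (x ∷ p , refl , sym eq)
++-cut (x ∷ p) (y ∷ u) eq with ∷-injectiveˡ eq | ++-cut p u (∷-injectiveʳ eq)
... | refl | inj₁ (r , e , e′) = inj₁ (r , cong (x ∷_) e , e′)
... | refl | inj₂ (r , e , e′) = inj₂ (r , cong (x ∷_) e , e′)

-- Recursion on the bracketing carries the new letter into the factor containing its position, down
-- to a left end or a single letter, where it is multiplied as a neutral element.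
insert-unit : ∀ {x g} u v → Evaluates 𝔾 x g → x ≡ u ++ v → Evaluates 𝔾 (u ++ unit ∷ v) g
insert-unit [] v e refl = split (single unit) e
insert-unit (_ ∷ []) [] (single a) refl = subst (Evaluates 𝔾 _) (𝔾-identityʳ a) (split (single a) (single unit))
insert-unit (y ∷ u) v (split {p} {q} {a} {b} e f) eq with ++-cut p (y ∷ u) eq
... | inj₁ (r , e₁ , e₂) =
  subst (λ l → Evaluates 𝔾 l (𝔾 a b)) (trans (sym (++-assoc p r (unit ∷ v))) (cong (_++ unit ∷ v) (sym e₁)))
    (split e (insert-unit r v f e₂))
... | inj₂ (r , e₁ , refl) =
  subst (λ l → Evaluates 𝔾 l (𝔾 a b)) (++-assoc (y ∷ u) (unit ∷ r) q) (split (insert-unit (y ∷ u) r e e₁) f)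

strip : List Letter → List Letter
strip [] = []
strip (unit ∷ v) = strip v
strip (a@(suc _) ∷ v) = a ∷ strip v

strip-++ : ∀ u v → strip (u ++ v) ≡ strip u ++ strip v
strip-++ [] v = refl
strip-++ (unit ∷ u) v = strip-++ u v
strip-++ (suc a ∷ u) v = cong (suc a ∷_) (strip-++ u v)

-- Fillers may be inserted into an evaluation. The opposite passage, which deletes them, is made for
-- runs, in `Run-strip`, where no bracketing has to be repaired.
Evaluates-strip⁻ : ∀ {g} v → Evaluates 𝔾 (strip v) g → Evaluates 𝔾 v g
Evaluates-strip⁻ v = go [] v
  where
  go : ∀ u v {g} → Evaluates 𝔾 (u ++ strip v) g → Evaluates 𝔾 (u ++ v) g
  go u [] e = e
  go u (unit ∷ v) {g} e = insert-unit u v (go u v e) refl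
  go u (suc a ∷ v) {g} e = subst (λ l → Evaluates 𝔾 l g) (++-assoc u [ suc a ] v)
    (go (u ++ [ suc a ]) v (subst (λ l → Evaluates 𝔾 l g) (sym (++-assoc u [ suc a ] (strip v))) e))

Run-strip : ∀ {v s t} → Run v s t → Run (strip v) s t
Run-strip done = done
Run-strip {unit ∷ v} (move refl r) = Run-strip r
Run-strip {suc a ∷ v} (move p r) = move p (Run-strip r)
Run-strip (skip {a} {v} x o r) rewrite strip-++ (a ∷ x) (close ∷ v) with o
... | inj₁ refl = skip (strip x) o (Run-strip r)
... | inj₂ refl = skip (strip x) o (Run-strip r)

loop : {A : Set} → (ℕ → List A) → ℕ → List A
loop f zero = []
loop f (suc n) = f 0 ++ loop (f ∘ suc) n

loop-+ : ∀ {A : Set} (f : ℕ → List A) m n → loop f (m + n) ≡ loop f m ++ loop (f ∘ (m +_)) n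
loop-+ f zero n = refl
loop-+ f (suc m) n = trans (cong (f 0 ++_) (loop-+ (f ∘ suc) m n)) (sym (++-assoc (f 0) _ _))

loop-cong : ∀ {A : Set} {f g : ℕ → List A} → (∀ x → f x ≡ g x) → ∀ n → loop f n ≡ loop g n
loop-cong h zero = refl
loop-cong h (suc n) = cong₂ _++_ (h 0) (loop-cong (h ∘ suc) n)

strip-loop : ∀ f n → strip (loop f n) ≡ loop (strip ∘ f) n
strip-loop f zero = refl
strip-loop f (suc n) = trans (strip-++ (f 0) _) (cong (strip (f 0) ++_) (strip-loop (f ∘ suc) n))

strip-concat-tabulate : ∀ {n} (f : Fin n → List Letter) →
  strip (concat (tabulate f)) ≡ concat (tabulate (strip ∘ f))
strip-concat-tabulate {zero} f = refl
strip-concat-tabulate {suc n} f =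
  trans (strip-++ (f zero) _) (cong (strip (f zero) ++_) (strip-concat-tabulate (f ∘ suc)))

loop-* : ∀ {A : Set} (f : ℕ → List A) n m →
  concat (tabulate {n = n} (λ i → loop (λ x → f (toℕ i * m + x)) m)) ≡ loop f (n * m)
loop-* f zero m = refl
loop-* f (suc n) m = trans
  (cong (loop f m ++_) (trans
    (cong concat (tabulate-cong {n = n} λ i → loop-cong (λ x → cong f (+-assoc m (toℕ i * m) x)) m))
    (loop-* (f ∘ (m +_)) n m)))
  (sym (loop-+ f m (n * m)))

-- Most significant digit first, so that the lexicographic order of tuples is the order of their
-- values.
num : ∀ {n m} → Vec (Fin n) m → ℕ
num [] = 0
num {n} {suc m} (d ∷ ds) = toℕ d * n ^ m + num ds

emissions : ∀ {n} m → (Vec (Fin n) m → Letter) → List Letter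
emissions zero f = [ f [] ]
emissions (suc m) f = concat (tabulate λ i → emissions m (λ ds → f (i ∷ ds)))

emissions-tuples : ∀ {n} m (f : Vec (Fin n) m → Letter) →
  map (f ∘ tabulateᵛ) (tuples n m) ≡ emissions m f
emissions-tuples zero f = refl
emissions-tuples {n} (suc m) f = begin
  map (f ∘ tabulateᵛ) (concatMap (λ i → map (extend i) (tuples n m)) (allFin n))
    ≡⟨ map-concatMap (f ∘ tabulateᵛ) (λ i → map (extend i) (tuples n m)) (allFin n) ⟩
  concatMap (λ i → map (f ∘ tabulateᵛ) (map (extend i) (tuples n m))) (allFin n)
    ≡⟨ cong concat (map-tabulate id (λ i → map (f ∘ tabulateᵛ) (map (extend i) (tuples n m)))) ⟩
  concat (tabulate (λ i → map (f ∘ tabulateᵛ) (map (extend i) (tuples n m))))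
    ≡⟨ cong concat (tabulate-cong λ i →
         trans (sym (map-∘ˡ (tuples n m))) (emissions-tuples m (λ ds → f (i ∷ ds)))) ⟩
  emissions (suc m) f ∎
  where open ≡-Reasoning

emissions-cong : ∀ {n} m {f g : Vec (Fin n) m → Letter} → (∀ ds → f ds ≡ g ds) → emissions m f ≡ emissions m g
emissions-cong zero h = cong [_] (h [])
emissions-cong (suc m) h = cong concat (tabulate-cong λ i → emissions-cong m (h ∘ (i ∷_)))

strip-emissions-num : ∀ {n} k m (f : ℕ → Vec (Fin n) m → Letter) →
  strip (emissions (k + m) (λ ds → f (num (takeᵛ k ds)) (dropᵛ k ds)))
  ≡ loop (λ x → strip (emissions m (f x))) (n ^ k)
strip-emissions-num zero m f = sym (++-identityʳ _)
strip-emissions-num {n} (suc k) m f = trans (strip-concat-tabulate {n} _) (trans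
  (cong concat (tabulate-cong {n = n} λ i → strip-emissions-num k m (λ x → f (toℕ i * n ^ k + x))))
  (loop-* (λ x → strip (emissions m (f x))) n (n ^ k)))

-- The constants min and max are the digits that a formula can name in every universe. They must
-- differ for a branching, hence the base `suc (suc b)`.
strip-emissions-alt : ∀ {b} m (f : Vec (Fin (suc (suc b))) (suc m) → Letter) →
  (∀ i ds → i ≢ zero → i ≢ fromℕ (suc b) → f (i ∷ ds) ≡ unit) →
  strip (emissions (suc m) f) ≡
  strip (emissions m (f ∘ (zero ∷_))) ++ strip (emissions m (f ∘ (fromℕ (suc b) ∷_)))
strip-emissions-alt {b} m f h = trans (strip-++ (emissions m (f ∘ (zero ∷_))) _)
  (cong (strip (emissions m (f ∘ (zero ∷_))) ++_)
    (trans (strip-concat-tabulate (λ i → emissions m (f ∘ (suc i ∷_))))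
      (last-only b (λ i → strip (emissions m (f ∘ (suc i ∷_))))
        (λ i i≢ → blank m _ (λ ds → h (suc i) ds (λ ()) (i≢ ∘ λ { refl → refl }))))))
  where
  blank : ∀ {n} m (f : Vec (Fin n) m → Letter) → (∀ ds → f ds ≡ unit) → strip (emissions m f) ≡ []
  blank zero f h rewrite h [] = refl
  blank {n} (suc m) f h = trans (strip-concat-tabulate {n} _)
    (trans (cong concat (tabulate-cong {n = n} λ i → blank m (f ∘ (i ∷_)) (h ∘ (i ∷_)))) (all-blank n))
    where
    all-blank : ∀ n → concat (tabulate {n = n} λ _ → []) ≡ ([] {A = Letter})
    all-blank zero = refl
    all-blank (suc n) = all-blank n
  last-only : ∀ b (g : Fin (suc b) → List Letter) → (∀ i → i ≢ fromℕ b → g i ≡ []) →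
    concat (tabulate g) ≡ g (fromℕ b)
  last-only zero g h = ++-identityʳ _
  last-only (suc b) g h rewrite h zero (λ ()) = last-only b (g ∘ suc) (λ i i≢ → h (suc i) (i≢ ∘ λ { refl → refl }))

-- Conditions on numbers and generators of words.

isLetter : ∀ {s} → Fin s → InSym s → Bool
isLetter a lend = false
isLetter a rend = false
isLetter a (letter x) = ⌊ x ≟ a ⌋

data Cond (s e : ℕ) : Set where
  always   : Cond s e
  less     : Fin e → Fin e → Cond s e
  letterAt : Fin s → Fin e → Cond s e
  lastAt   : Fin e → Cond s e
  neg      : Cond s e → Cond s e

-- The number x stands for the position x + 1 of the input word.
holds : ∀ {s e} → Word s → Vec ℕ e → Cond s e → Bool
holds w ρ always = true
holds w ρ (less i j) = lookupᵛ ρ i <ᵇ lookupᵛ ρ j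
holds w ρ (letterAt a i) = isLetter a (readAt w (suc (lookupᵛ ρ i)))
holds w ρ (lastAt i) = suc (lookupᵛ ρ i) ≡ᵇ length w
holds w ρ (neg c) = not (holds w ρ c)

-- Descriptions of words indexed by tuples of m digits, under an environment of e numbers: alt reads one
-- digit (min and max select a branch, other values give unit), bind reads k digits as a number,
-- rep ignores k digits.  A leaf carries the predecessor of a letter, since unit is letter zero.
data Gen (s k e : ℕ) : ℕ → Set where
  leaf : Cond s e → Fin 9 → Gen s k e 0
  alt  : ∀ {m} → Gen s k e m → Gen s k e m → Gen s k e (suc m)
  bind : ∀ {m} → Gen s k (suc e) m → Gen s k e (k + m)
  rep  : ∀ {m} → Gen s k e m → Gen s k e (k + m)

module _ {s k : ℕ} (w : Word s) (b : ℕ) where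
  eval : ∀ {e m} → Gen s k e m → Vec ℕ e → Vec (Fin (suc b)) m → Letter
  eval (leaf c a) ρ [] = if holds w ρ c then suc a else unit
  eval (alt g h) ρ (d ∷ ds) =
    if ⌊ d ≟ zero ⌋ then eval g ρ ds else (if ⌊ d ≟ fromℕ b ⌋ then eval h ρ ds else unit)
  eval (bind g) ρ ds = eval g (num (takeᵛ k ds) ∷ ρ) (dropᵛ k ds)
  eval (rep g) ρ ds = eval g ρ (dropᵛ k ds)

  output : ∀ {e m} → Gen s k e m → Vec ℕ e → List Letter
  output (leaf c a) ρ = if holds w ρ c then [ suc a ] else []
  output (alt g h) ρ = output g ρ ++ output h ρ
  output (bind g) ρ = loop (λ x → output g (x ∷ ρ)) (suc b ^ k)
  output (rep g) ρ = loop (λ _ → output g ρ) (suc b ^ k)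

strip-emissions : ∀ {s k e m} (w : Word s) b (g : Gen s k e m) ρ →
  strip (emissions m (eval w (suc b) g ρ)) ≡ output w (suc b) g ρ
strip-emissions w b (leaf c a) ρ with holds w ρ c
... | true = refl
... | false = refl
strip-emissions {m = suc m} w b (alt g h) ρ = trans
  (strip-emissions-alt m (eval w (suc b) (alt g h) ρ) middle)
  (cong₂ _++_ (strip-emissions w b g ρ)
    (trans (cong strip (emissions-cong m top)) (strip-emissions w b h ρ)))
  where
  middle : ∀ i ds → i ≢ zero → i ≢ fromℕ (suc b) → eval w (suc b) (alt g h) ρ (i ∷ ds) ≡ unit
  middle i ds p q with i ≟ zero | i ≟ fromℕ (suc b)
  ... | yes e | _ = ⊥-elim (p e)
  ... | no _ | yes e = ⊥-elim (q e)
  ... | no _ | no _ = refl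
  top : ∀ ds → eval w (suc b) (alt g h) ρ (fromℕ (suc b) ∷ ds) ≡ eval w (suc b) h ρ ds
  top ds with fromℕ (suc b) ≟ fromℕ (suc b)
  ... | yes _ = refl
  ... | no p = ⊥-elim (p refl)
strip-emissions {k = k} w b (bind {m} g) ρ = trans
  (strip-emissions-num k m (λ x → eval w (suc b) g (x ∷ ρ)))
  (loop-cong (λ x → strip-emissions w b g (x ∷ ρ)) (suc (suc b) ^ k))
strip-emissions {k = k} w b (rep {m} g) ρ = trans
  (strip-emissions-num k m (λ _ → eval w (suc b) g ρ))
  (loop-cong (λ _ → strip-emissions w b g ρ) (suc (suc b) ^ k))

-- Defining formulas

num-< : ∀ {n m} (ds : Vec (Fin n) m) → num ds < n ^ m
num-< [] = s≤s z≤n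
num-< {n} {suc m} (d ∷ ds) = begin-strict
  toℕ d * n ^ m + num ds  <⟨ +-monoʳ-< (toℕ d * n ^ m) (num-< ds) ⟩
  toℕ d * n ^ m + n ^ m   ≡⟨ +-comm (toℕ d * n ^ m) (n ^ m) ⟩
  suc (toℕ d) * n ^ m     ≤⟨ *-monoˡ-≤ (n ^ m) (toℕ<n d) ⟩
  n * n ^ m               ∎
  where open ≤-Reasoning

⌊⌋-yes : ∀ {P : Set} (p? : Dec P) → P → ⌊ p? ⌋ ≡ true
⌊⌋-yes p? p = trans (isYes≗does p?) (dec-true p? p)

⌊⌋-no : ∀ {P : Set} (p? : Dec P) → ¬ P → ⌊ p? ⌋ ≡ false
⌊⌋-no p? p = trans (isYes≗does p?) (dec-false p? p)

<ᵇ-true : ∀ {m n} → m < n → (m <ᵇ n) ≡ true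
<ᵇ-true {m} {n} p = dec-true (m <? n) p

<ᵇ-false : ∀ {m n} → ¬ (m < n) → (m <ᵇ n) ≡ false
<ᵇ-false {m} {n} p = dec-false (m <? n) p

≡ᵇ-false : ∀ {m n} → m ≢ n → (m ≡ᵇ n) ≡ false
≡ᵇ-false {m} {n} p = dec-false (m ≟ℕ n) p

+-cancelˡ-<ᵇ : ∀ c m n → (c + m <ᵇ c + n) ≡ (m <ᵇ n)
+-cancelˡ-<ᵇ zero m n = refl
+-cancelˡ-<ᵇ (suc c) m n = +-cancelˡ-<ᵇ c m n

readAt-beyond : ∀ {s} (w : Word s) {i} → length w < i → readAt w i ≡ rend
readAt-beyond [] {suc i} _ = refl
readAt-beyond (x ∷ w) {suc (suc i)} (s≤s p) = readAt-beyond w p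

readAt-lookup : ∀ {s} (w : Word s) i → readAt w (suc (toℕ i)) ≡ letter (lookupᵛ (fromList w) i)
readAt-lookup (x ∷ w) zero = refl
readAt-lookup (x ∷ w) (suc i) = readAt-lookup w i

module _ {s K : ℕ} where
  trueF : Formula s K
  trueF = tmin ≐ tmin

  constF : Bool → Formula s K
  constF b = if b then trueF else ¬' trueF

  ifF : Formula s K → Formula s K → Formula s K → Formula s K
  ifF φ α β = (φ ∧' α) ∨' (¬' φ ∧' β)

  lexLessF : ∀ {m} → Vec (Fin K) m → Vec (Fin K) m → Formula s K
  lexLessF [] [] = ¬' trueF
  lexLessF (x ∷ xs) (y ∷ ys) = (var x ⋖ var y) ∨' ((var x ≐ var y) ∧' lexLessF xs ys)

  -- A number below the word length has all its digits but the last equal to 0.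
  letterAtF : ∀ {m} → Fin s → Vec (Fin K) (suc m) → Formula s K
  letterAtF a (x ∷ []) = P a (var x)
  letterAtF a (x ∷ xs@(_ ∷ _)) = (var x ≐ tmin) ∧' letterAtF a xs

  lastAtF : ∀ {m} → Vec (Fin K) (suc m) → Formula s K
  lastAtF (x ∷ []) = var x ≐ tmax
  lastAtF (x ∷ xs@(_ ∷ _)) = (var x ≐ tmin) ∧' lastAtF xs

  module _ {k : ℕ} where
    holdsF : ∀ {e} → Vec (Vec (Fin K) (suc k)) e → Cond s e → Formula s K
    holdsF ρ always = trueF
    holdsF ρ (less i j) = lexLessF (lookupᵛ ρ i) (lookupᵛ ρ j)
    holdsF ρ (letterAt a i) = letterAtF a (lookupᵛ ρ i)
    holdsF ρ (lastAt i) = lastAtF (lookupᵛ ρ i)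
    holdsF ρ (neg c) = ¬' (holdsF ρ c)

    evalF : ∀ {e m} → Gen s (suc k) e m → Vec (Vec (Fin K) (suc k)) e → Vec (Fin K) m → Letter → Formula s K
    evalF (leaf c a) ρ [] l = ifF (holdsF ρ c) (constF ⌊ suc a ≟ l ⌋) (constF ⌊ unit ≟ l ⌋)
    evalF (alt g h) ρ (d ∷ ds) l =
      ifF (var d ≐ tmin) (evalF g ρ ds l) (ifF (var d ≐ tmax) (evalF h ρ ds l) (constF ⌊ unit ≟ l ⌋))
    evalF (bind g) ρ ds l = evalF g (takeᵛ (suc k) ds ∷ ρ) (dropᵛ (suc k) ds) l
    evalF (rep g) ρ ds l = evalF g ρ (dropᵛ (suc k) ds) l

  module _ (x : Fin s) (w : Word s) (X : Fin K → Fin (suc (length w))) where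
    private
      xw : Word s
      xw = x ∷ w

      b : ℕ
      b = length w

      ⟦_⟧ : Formula s K → Bool
      ⟦ φ ⟧ = sat (fromList xw) X φ

      value : ∀ {m} → Vec (Fin K) m → ℕ
      value ds = num (mapᵛ X ds)

    sat-const : ∀ c → ⟦ constF c ⟧ ≡ c
    sat-const true = refl
    sat-const false = refl

    sat-if : ∀ φ α β {c} → ⟦ φ ⟧ ≡ c → ⟦ ifF φ α β ⟧ ≡ (if c then ⟦ α ⟧ else ⟦ β ⟧)
    sat-if φ α β refl with ⟦ φ ⟧
    ... | true = ∨-identityʳ _
    ... | false = refl

    sat-lexLess : ∀ {m} (ds es : Vec (Fin K) m) → ⟦ lexLessF ds es ⟧ ≡ (value ds <ᵇ value es)
    sat-lexLess [] [] = refl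
    sat-lexLess {suc m} (d ∷ ds) (e ∷ es) with <-cmp (toℕ (X d)) (toℕ (X e))
    ... | tri< d<e _ _ rewrite <ᵇ-true d<e = sym (<ᵇ-true (begin-strict
      toℕ (X d) * suc b ^ m + value ds  <⟨ +-monoʳ-< (toℕ (X d) * suc b ^ m) (num-< (mapᵛ X ds)) ⟩
      toℕ (X d) * suc b ^ m + suc b ^ m ≡⟨ +-comm (toℕ (X d) * suc b ^ m) _ ⟩
      suc (toℕ (X d)) * suc b ^ m       ≤⟨ *-monoˡ-≤ (suc b ^ m) d<e ⟩
      toℕ (X e) * suc b ^ m             ≤⟨ m≤m+n _ _ ⟩
      toℕ (X e) * suc b ^ m + value es  ∎))
      where open ≤-Reasoning
    ... | tri≈ d≮e d≡e _
      rewrite <ᵇ-false d≮e | ⌊⌋-yes (X d ≟ X e) (toℕ-injective d≡e) | d≡e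
            | +-cancelˡ-<ᵇ (toℕ (X e) * suc b ^ m) (value ds) (value es) = sat-lexLess ds es
    ... | tri> d≮e d≢e e<d
      rewrite <ᵇ-false d≮e | ⌊⌋-no (X d ≟ X e) (d≢e ∘ cong toℕ) = sym (<ᵇ-false (<-asym (begin-strict
      toℕ (X e) * suc b ^ m + value es  <⟨ +-monoʳ-< (toℕ (X e) * suc b ^ m) (num-< (mapᵛ X es)) ⟩
      toℕ (X e) * suc b ^ m + suc b ^ m ≡⟨ +-comm (toℕ (X e) * suc b ^ m) _ ⟩
      suc (toℕ (X e)) * suc b ^ m       ≤⟨ *-monoˡ-≤ (suc b ^ m) e<d ⟩
      toℕ (X d) * suc b ^ m             ≤⟨ m≤m+n _ _ ⟩
      toℕ (X d) * suc b ^ m + value ds  ∎)))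
      where open ≤-Reasoning

    private
      large : ∀ {m} d (ds : Vec (Fin K) (suc m)) → X d ≢ zero → suc b ≤ value (d ∷ ds)
      large {m} d ds d≢0 with X d
      ... | zero = ⊥-elim (d≢0 refl)
      ... | suc i = begin
        suc b                            ≡⟨ *-identityʳ (suc b) ⟨
        suc b * 1                        ≤⟨ *-monoʳ-≤ (suc b) (m^n>0 (suc b) m) ⟩
        suc b ^ suc m                    ≤⟨ m≤m+n _ _ ⟩
        suc (toℕ i) * suc b ^ suc m      ≤⟨ m≤m+n _ _ ⟩
        suc (toℕ i) * suc b ^ suc m + value ds ∎
        where open ≤-Reasoning

      small : ∀ {m} d (ds : Vec (Fin K) (suc m)) → X d ≡ zero → value (d ∷ ds) ≡ value ds
      small d ds eq rewrite eq = refl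

      digit : ∀ d → value (d ∷ []) ≡ toℕ (X d)
      digit d = trans (+-identityʳ _) (*-identityʳ _)

    sat-letterAt : ∀ {m} a (ds : Vec (Fin K) (suc m)) →
      ⟦ letterAtF a ds ⟧ ≡ isLetter a (readAt xw (suc (value ds)))
    sat-letterAt a (d ∷ []) rewrite digit d | readAt-lookup xw (X d) = refl
    sat-letterAt a (d ∷ ds@(_ ∷ _)) with X d ≟ zero
    ... | yes p rewrite small d ds p = sat-letterAt a ds
    -- The position lies behind the word, where `readAt` gives `rend`, which passes no letter test.
    ... | no p rewrite readAt-beyond xw (s≤s (large d ds p)) = refl

    sat-lastAt : ∀ {m} (ds : Vec (Fin K) (suc m)) → ⟦ lastAtF ds ⟧ ≡ (value ds ≡ᵇ b)
    sat-lastAt (d ∷ []) rewrite digit d with X d ≟ fromℕ b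
    ... | yes p rewrite p | toℕ-fromℕ b = sym (dec-true (b ≟ℕ b) refl)
    ... | no p = sym (≡ᵇ-false (λ e → p (toℕ-injective (trans e (sym (toℕ-fromℕ b))))))
    sat-lastAt (d ∷ ds@(_ ∷ _)) with X d ≟ zero
    ... | yes p rewrite small d ds p = sat-lastAt ds
    ... | no p = sym (≡ᵇ-false (λ e → 1+n≰n (subst (suc b ≤_) e (large d ds p))))

    module _ {k : ℕ} where
      sat-holds : ∀ {e} (ρ : Vec (Vec (Fin K) (suc k)) e) c →
        ⟦ holdsF ρ c ⟧ ≡ holds xw (mapᵛ value ρ) c
      sat-holds ρ always = refl
      sat-holds ρ (less i j)
        rewrite lookup-map i value ρ | lookup-map j value ρ = sat-lexLess (lookupᵛ ρ i) (lookupᵛ ρ j)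
      sat-holds ρ (letterAt a i) rewrite lookup-map i value ρ = sat-letterAt a (lookupᵛ ρ i)
      sat-holds ρ (lastAt i) rewrite lookup-map i value ρ = sat-lastAt (lookupᵛ ρ i)
      sat-holds ρ (neg c) = cong not (sat-holds ρ c)

      sat-eval : ∀ {e m} (g : Gen s (suc k) e m) (ρ : Vec (Vec (Fin K) (suc k)) e) ds l →
        ⟦ evalF g ρ ds l ⟧ ≡ ⌊ eval xw b g (mapᵛ value ρ) (mapᵛ X ds) ≟ l ⌋
      sat-eval (leaf c a) ρ [] l = trans (sat-if (holdsF ρ c) (constF ⌊ suc a ≟ l ⌋) (constF ⌊ unit ≟ l ⌋) (sat-holds ρ c)) (by (holds xw (mapᵛ value ρ) c))
        where
        by : ∀ q → (if q then ⟦ constF ⌊ suc a ≟ l ⌋ ⟧ else ⟦ constF ⌊ unit ≟ l ⌋ ⟧) ≡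
                   ⌊ (if q then suc a else unit) ≟ l ⌋
        by true = sat-const ⌊ suc a ≟ l ⌋
        by false = sat-const ⌊ unit ≟ l ⌋
      sat-eval (alt g h) ρ (d ∷ ds) l = trans (sat-if (var d ≐ tmin) (evalF g ρ ds l) (ifF (var d ≐ tmax) (evalF h ρ ds l) (constF ⌊ unit ≟ l ⌋)) refl) (by ⌊ X d ≟ zero ⌋)
        where
        by : ∀ q → (if q then ⟦ evalF g ρ ds l ⟧ else ⟦ ifF (var d ≐ tmax) (evalF h ρ ds l) (constF ⌊ unit ≟ l ⌋) ⟧) ≡
                   ⌊ (if q then eval xw b g (mapᵛ value ρ) (mapᵛ X ds) else
                       (if ⌊ X d ≟ fromℕ b ⌋ then eval xw b h (mapᵛ value ρ) (mapᵛ X ds) else unit)) ≟ l ⌋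
        by′ : ∀ q → (if q then ⟦ evalF h ρ ds l ⟧ else ⟦ constF ⌊ unit ≟ l ⌋ ⟧) ≡
                    ⌊ (if q then eval xw b h (mapᵛ value ρ) (mapᵛ X ds) else unit) ≟ l ⌋
        by true = sat-eval g ρ ds l
        by false = trans (sat-if (var d ≐ tmax) (evalF h ρ ds l) (constF ⌊ unit ≟ l ⌋) refl) (by′ ⌊ X d ≟ fromℕ b ⌋)
        by′ true = sat-eval h ρ ds l
        by′ false = sat-const ⌊ unit ≟ l ⌋
      sat-eval (bind g) ρ ds l
        rewrite take-map X (suc k) ds | drop-map X (suc k) ds = sat-eval g (takeᵛ (suc k) ds ∷ ρ) (dropᵛ (suc k) ds) l
      sat-eval (rep g) ρ ds l rewrite drop-map X (suc k) ds = sat-eval g ρ (dropᵛ (suc k) ds) l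

-- Each formula tests equality with one letter, so at most one holds and the least index is the only
-- one. For the last letter none holds, and the default applies.
letterOf-unique : ∀ {s n k m} (w : Vec (Fin s) (suc n)) (φ : Fin m → Formula s k) X (a : Fin (suc m)) →
  (∀ j → sat w X (φ j) ≡ ⌊ a ≟ inject₁ j ⌋) → letterOf w φ X ≡ a
letterOf-unique {m = zero} w φ X zero h = refl
letterOf-unique {m = suc m} w φ X a h rewrite h zero with a
... | zero = refl
... | suc a′ = cong suc (letterOf-unique w (φ ∘ suc) X a′ (λ j → trans (h (suc j)) (shift a′ (inject₁ j))))
  where
  shift : ∀ {n} (i j : Fin n) → ⌊ suc i ≟ suc j ⌋ ≡ ⌊ i ≟ j ⌋
  shift i j with i ≟ j
  ... | yes _ = refl
  ... | no _ = refl

-- Prefix rewriting of stacks of numbers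

record Affine : Set where
  constructor affine
  field
    coefficient : ℕ
    variable′   : Fin 4
    constant    : ℕ

⟦_⟧ᵃ : Affine → Vec ℕ 4 → ℕ
⟦ affine α i β ⟧ᵃ xs = α * lookupᵛ xs i + β

values : List Affine → Vec ℕ 4 → List ℕ
values ts xs = map (λ t → ⟦ t ⟧ᵃ xs) ts

record Schema (s : ℕ) : Set where
  constructor schema
  field
    guard  : Cond s 4
    pops   : List Affine
    pushes : List Affine

open Schema

-- The bound on `xs` reflects that the word lists only the instances with values below `N`; the
-- numbers on the stack may be larger.
data Step {s} (w : Word s) (N : ℕ) (Θ : List (Schema s)) (S T : List ℕ) : Set where
  apply : ∀ θ xs U → θ ∈ Θ → (∀ i → lookupᵛ xs i < N) → holds w xs (guard θ) ≡ true →
          S ≡ values (pops θ) xs ++ U → T ≡ values (pushes θ) xs ++ U → Step w N Θ S T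

data Steps {s} (w : Word s) (N : ℕ) (Θ : List (Schema s)) (S : List ℕ) : ℕ → List ℕ → Set where
  stop : Steps w N Θ S 0 S
  more : ∀ {T U n} → Step w N Θ S T → Steps w N Θ T n U → Steps w N Θ S (suc n) U

-- Each number x is the block 1ˣ#, so that comparing and multiplying by constants needs no arithmetic
-- on positions.
unary : List ℕ → Stack
unary [] = []
unary (x ∷ S) = replicate x true ++ false ∷ unary S

popNum pushNum : ℕ → List Letter
popNum x = replicate x pop₁ ++ [ pop# ]
pushNum x = push# ∷ replicate x push₁

-- The top of the stack is the head of the list. Pushing builds from the bottom, so it reverses both
-- the list and each single block.
popAll pushAll : List ℕ → List Letter
popAll [] = []
popAll (x ∷ S) = popNum x ++ popAll S
pushAll [] = []
pushAll (x ∷ S) = pushAll S ++ pushNum x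

-- A single `junk`, which no run survives, disables a block with a false guard; the other letters
-- then need not depend on the guard.
content : ∀ {s} → Word s → Schema s → Vec ℕ 4 → List Letter
content w θ xs = (if holds w xs (guard θ) then [] else [ junk ]) ++
                 popAll (values (pops θ) xs) ++ pushAll (values (pushes θ) xs)

content-Content : ∀ {s} (w : Word s) θ xs → All Content (content w θ xs)
content-Content w θ xs = All-++⁺ (guarded (holds w xs (guard θ)))
  (All-++⁺ (popping-all (values (pops θ) xs)) (pushing-all (values (pushes θ) xs)))
  where
  guarded : ∀ b → All Content (if b then [] else [ junk ])
  guarded true = []
  guarded false = failing ∷ []
  popping-all : ∀ S → All Content (popAll S)
  popping-all [] = []
  popping-all (x ∷ S) = All-++⁺ (All-++⁺ (All-replicate⁺ x (popping true)) (popping false ∷ [])) (popping-all S)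
  pushing-all : ∀ S → All Content (pushAll S)
  pushing-all [] = []
  pushing-all (x ∷ S) = All-++⁺ (pushing-all S) (pushing false ∷ All-replicate⁺ x (pushing true))

Moves-++ : ∀ {u v s m t} → Moves u s m → Moves v m t → Moves (u ++ v) s t
Moves-++ done ν = ν
Moves-++ (push x μ) ν = push x (Moves-++ μ ν)
Moves-++ (pop x μ) ν = pop x (Moves-++ μ ν)

private
  pushL≢popL : ∀ x y → pushL x ≢ popL y
  pushL≢popL true true ()
  pushL≢popL true false ()
  pushL≢popL false true ()
  pushL≢popL false false ()

  pop-inv : ∀ y {a v s t} → Moves (a ∷ v) s t → a ≡ popL y → ∃[ r ] (s ≡ y ∷ r × Moves v r t)
  pop-inv y (push x μ) e = ⊥-elim (pushL≢popL x y e)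
  pop-inv true (pop true μ) _ = _ , refl , μ
  pop-inv false (pop false μ) _ = _ , refl , μ
  pop-inv true (pop false μ) ()
  pop-inv false (pop true μ) ()

  push-inv : ∀ y {a v s t} → Moves (a ∷ v) s t → a ≡ pushL y → Moves v (y ∷ s) t
  push-inv y (pop x μ) e = ⊥-elim (pushL≢popL y x (sym e))
  push-inv true (push true μ) _ = μ
  push-inv false (push false μ) _ = μ
  push-inv true (push false μ) ()
  push-inv false (push true μ) ()

  junk-inv : ∀ {a v s t} → Moves (a ∷ v) s t → a ≢ junk
  junk-inv (push true _) ()
  junk-inv (push false _) ()
  junk-inv (pop true _) ()
  junk-inv (pop false _) ()

Moves-popNum : ∀ x S → Moves (popNum x) (unary (x ∷ S)) (unary S)
Moves-popNum zero S = pop false done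
Moves-popNum (suc x) S = pop true (Moves-popNum x S)

Moves-popAll : ∀ R S → Moves (popAll R) (unary (R ++ S)) (unary S)
Moves-popAll [] S = done
Moves-popAll (x ∷ R) S = Moves-++ (Moves-popNum x (R ++ S)) (Moves-popAll R S)

replicate-∷ : ∀ {A : Set} n (a : A) l → replicate n a ++ a ∷ l ≡ a ∷ replicate n a ++ l
replicate-∷ zero a l = refl
replicate-∷ (suc n) a l = cong (a ∷_) (replicate-∷ n a l)

Moves-push₁ : ∀ x s → Moves (replicate x push₁) s (replicate x true ++ s)
Moves-push₁ zero s = done
Moves-push₁ (suc x) s =
  push true (subst (Moves (replicate x push₁) (true ∷ s)) (replicate-∷ x true s) (Moves-push₁ x (true ∷ s)))

Moves-pushAll : ∀ R S → Moves (pushAll R) (unary S) (unary (R ++ S))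
Moves-pushAll [] S = done
Moves-pushAll (x ∷ R) S = Moves-++ (Moves-pushAll R S) (push false (Moves-push₁ x (false ∷ unary (R ++ S))))

pop₁-inv : ∀ x {v s t} → Moves (replicate x pop₁ ++ v) s t → ∃[ r ] (s ≡ replicate x true ++ r × Moves v r t)
pop₁-inv zero μ = _ , refl , μ
pop₁-inv (suc x) μ with pop-inv true μ refl
... | r , refl , ν with pop₁-inv x ν
... | r′ , refl , ν′ = r′ , refl , ν′

-- As `#` ends every number, popping 1ˣ# succeeds only on the top number x itself, and an encoding
-- of a stack of numbers is left.
unary-inv : ∀ x S {r} → unary S ≡ replicate x true ++ false ∷ r → ∃[ R ] (S ≡ x ∷ R × r ≡ unary R)
unary-inv x [] eq with x | eq
... | zero | ()
... | suc _ | ()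
unary-inv zero (zero ∷ S) eq = S , refl , sym (∷-injectiveʳ eq)
unary-inv zero (suc y ∷ S) ()
unary-inv (suc x) (zero ∷ S) ()
unary-inv (suc x) (suc y ∷ S) eq with unary-inv x (y ∷ S) (∷-injectiveʳ eq)
... | R , refl , e = R , refl , e

popAll-inv : ∀ R S {v t} → Moves (popAll R ++ v) (unary S) t → ∃[ U ] (S ≡ R ++ U × Moves v (unary U) t)
popAll-inv [] S μ = S , refl , μ
popAll-inv (x ∷ R) S {v} {t} μ
  with pop₁-inv x (subst (λ l → Moves l (unary S) t)
         (trans (++-assoc (popNum x) (popAll R) v) (++-assoc (replicate x pop₁) [ pop# ] (popAll R ++ v))) μ)
... | r , e , ν with pop-inv false ν refl
... | r′ , refl , ν′ with unary-inv x S e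
... | U , refl , refl with popAll-inv R U ν′
... | V , refl , ν″ = V , refl , ν″

push₁-inv : ∀ x {v s t} → Moves (replicate x push₁ ++ v) s t → Moves v (replicate x true ++ s) t
push₁-inv zero μ = μ
push₁-inv (suc x) {v} {s} {t} μ =
  subst (λ l → Moves v l t) (replicate-∷ x true s) (push₁-inv x (push-inv true μ refl))

pushAll-inv : ∀ R U {v t} → Moves (pushAll R ++ v) (unary U) t → Moves v (unary (R ++ U)) t
pushAll-inv [] U μ = μ
pushAll-inv (x ∷ R) U {v} {t} μ = push₁-inv x (push-inv false
  (pushAll-inv R U (subst (λ l → Moves l (unary U) t) (++-assoc (pushAll R) (pushNum x) v) μ)) refl)

Step⇒Moves : ∀ {s} {w : Word s} {θ xs} U → holds w xs (guard θ) ≡ true →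
  Moves (content w θ xs) (unary (values (pops θ) xs ++ U)) (unary (values (pushes θ) xs ++ U))
Step⇒Moves {θ = θ} {xs} U eq rewrite eq = Moves-++ (Moves-popAll (values (pops θ) xs) U) (Moves-pushAll (values (pushes θ) xs) U)

Moves⇒Step : ∀ {s} {w : Word s} {θ xs} S {t} → Moves (content w θ xs) (unary S) t →
  ∃[ U ] (holds w xs (guard θ) ≡ true × S ≡ values (pops θ) xs ++ U × t ≡ unary (values (pushes θ) xs ++ U))
Moves⇒Step {w = w} {θ} {xs} S {t} μ with holds w xs (guard θ)
... | false = ⊥-elim (junk-inv μ refl)
... | true with popAll-inv (values (pops θ) xs) S μ
... | U , e , ν with pushAll-inv (values (pushes θ) xs) U (subst (λ l → Moves l (unary U) t) (sym (++-identityʳ _)) ν)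
... | done = U , refl , e , refl

∈-loop : ∀ {A : Set} {a : A} (f : ℕ → List A) {n} x → x < n → a ∈ f x → a ∈ loop f n
∈-loop f {suc n} zero _ p = ∈-++⁺ˡ p
∈-loop f {suc n} (suc x) (s≤s x<n) p = ∈-++⁺ʳ (f 0) (∈-loop (f ∘ suc) x x<n p)

All-loop : ∀ {A : Set} {Q : A → Set} (f : ℕ → List A) n → (∀ x → x < n → All Q (f x)) → All Q (loop f n)
All-loop f zero h = []
All-loop f (suc n) h = All-++⁺ (h 0 (s≤s z≤n)) (All-loop (f ∘ suc) n (λ x p → h (suc x) (s≤s p)))

loop-cong-< : ∀ {A : Set} {f g : ℕ → List A} n → (∀ x → x < n → f x ≡ g x) → loop f n ≡ loop g n
loop-cong-< zero h = refl
loop-cong-< (suc n) h = cong₂ _++_ (h 0 (s≤s z≤n)) (loop-cong-< n (λ x p → h (suc x) (s≤s p)))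

blocks-loop : ∀ f n → blocks (loop f n) ≡ loop (blocks ∘ f) n
blocks-loop f zero = refl
blocks-loop f (suc n) = trans (blocks-++ (f 0) _) (cong (blocks (f 0) ++_) (blocks-loop (f ∘ suc) n))

blocks-concatMap : ∀ {A : Set} (f : A → List (List Letter)) l → blocks (concatMap f l) ≡ concatMap (blocks ∘ f) l
blocks-concatMap f [] = refl
blocks-concatMap f (x ∷ l) = trans (blocks-++ (f x) _) (cong (blocks (f x) ++_) (blocks-concatMap f l))

-- The block word that lists all instances of all schemas.

module _ {s : ℕ} (w : Word s) (N : ℕ) where
  instances : Schema s → List (List Letter)
  instances θ = loop (λ x₃ → loop (λ x₂ → loop (λ x₁ → loop (λ x₀ →
    [ content w θ (x₀ ∷ x₁ ∷ x₂ ∷ x₃ ∷ []) ]) N) N) N) N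

  -- A selection follows the order of the word, whereas the steps of a computation may use the
  -- instances in any order. So each round lists all of them and provides for one step.
  contents : List (Schema s) → List (List Letter)
  contents Θ = loop (λ _ → concatMap instances Θ) N

module _ {s : ℕ} {w : Word s} {N : ℕ} where
  Instance : List (Schema s) → List Letter → Set
  Instance Θ c = ∃[ θ ] ∃[ xs ] (θ ∈ Θ × (∀ i → lookupᵛ xs i < N) × c ≡ content w θ xs)

  instances-Instance : ∀ {Θ θ} → θ ∈ Θ → All (Instance Θ) (instances w N θ)
  instances-Instance {θ = θ} p =
    All-loop _ N λ x₃ p₃ → All-loop _ N λ x₂ p₂ → All-loop _ N λ x₁ p₁ → All-loop _ N λ x₀ p₀ →
      (θ , x₀ ∷ x₁ ∷ x₂ ∷ x₃ ∷ [] , p ,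
        (λ { zero → p₀ ; (suc zero) → p₁ ; (suc (suc zero)) → p₂ ; (suc (suc (suc zero))) → p₃ }) , refl) ∷ []

  ∈-instances : ∀ θ xs → (∀ i → lookupᵛ xs i < N) → content w θ xs ∈ instances w N θ
  ∈-instances θ (x₀ ∷ x₁ ∷ x₂ ∷ x₃ ∷ []) b =
    ∈-loop _ x₃ (b (suc (suc (suc zero)))) (∈-loop _ x₂ (b (suc (suc zero)))
      (∈-loop _ x₁ (b (suc zero)) (∈-loop _ x₀ (b zero) (here refl))))

  contents-Instance : ∀ Θ → All (Instance Θ) (contents w N Θ)
  contents-Instance Θ = All-loop _ N λ _ _ → go Θ id
    where
    go : ∀ Ξ → (∀ {θ} → θ ∈ Ξ → θ ∈ Θ) → All (Instance Θ) (concatMap (instances w N) Ξ)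
    go [] _ = []
    go (θ ∷ Ξ) h = All-++⁺ (instances-Instance (h (here refl))) (go Ξ (h ∘ there))

  contents-Content : ∀ Θ → All (All Content) (contents w N Θ)
  contents-Content Θ = All-map (λ { (θ , xs , _ , _ , refl) → content-Content w θ xs }) (contents-Instance Θ)

  Selection⇒Steps : ∀ {Θ cs} S → All (Instance Θ) cs → Selection cs (unary S) [] → ∃[ n ] Steps w N Θ S n []
  Selection⇒Steps {Θ} S ps σ = go S refl ps σ
    where
    empty : ∀ S → [] ≡ unary S → S ≡ []
    empty [] _ = refl
    empty (zero ∷ S) ()
    empty (suc x ∷ S) ()
    go : ∀ {cs r} S → r ≡ unary S → All (Instance Θ) cs → Selection cs r [] → ∃[ n ] Steps w N Θ S n []
    go S e _ done rewrite empty S e = 0 , stop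
    go S e (_ ∷ ps) (omit σ) = go S e ps σ
    go S refl ((θ , xs , θ∈ , b , refl) ∷ ps) (choose μ σ) =
      let U , g , e₁ , e₂ = Moves⇒Step {w = w} {θ} {xs} S μ
          n , r = go (values (pushes θ) xs ++ U) e₂ ps σ
      in suc n , more (apply θ xs U θ∈ b g e₁ refl) r

  Selection-idle : ∀ cs {s} → Selection cs s s
  Selection-idle [] = done
  Selection-idle (c ∷ cs) = omit (Selection-idle cs)

  Selection-++ : ∀ {cs ds s m t} → Selection cs s m → Selection ds m t → Selection (cs ++ ds) s t
  Selection-++ done τ = τ
  Selection-++ (omit σ) τ = omit (Selection-++ σ τ)
  Selection-++ (choose μ σ) τ = choose μ (Selection-++ σ τ)

  Selection-∈ : ∀ {c cs s t} → c ∈ cs → Moves c s t → Selection cs s t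
  Selection-∈ {cs = _ ∷ cs} (here refl) μ = choose μ (Selection-idle cs)
  Selection-∈ (there p) μ = omit (Selection-∈ p μ)

  Steps⇒Selection : ∀ {Θ S n} → n ≤ N → Steps w N Θ S n [] → Selection (contents w N Θ) (unary S) []
  Steps⇒Selection {Θ} n≤N r = go N n≤N r
    where
    go : ∀ {S n} m → n ≤ m → Steps w N Θ S n [] → Selection (loop (λ _ → concatMap (instances w N) Θ) m) (unary S) []
    go m _ stop = Selection-idle (loop (λ _ → concatMap (instances w N) Θ) m)
    go (suc m) (s≤s p) (more (apply θ xs U θ∈ b g refl refl) r) = Selection-++
      (Selection-∈ (∈-concatMap⁺ (instances w N) {xs = Θ} (Any-map (λ { refl → ∈-instances θ xs b }) θ∈))
        (Step⇒Moves {w = w} {θ} {xs} U g))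
      (go m p r)

-- Generators for the block words.

module _ {s k : ℕ} where
  never : ∀ {e} m → Gen s k e m
  never zero = leaf (neg always) zero
  never (suc m) = alt (never m) (never m)

  -- The branches of `alt` must read equally many digits; each surplus digit is read by an `alt`
  -- whose second branch emits nothing.
  pad : ∀ {e m} j → Gen s k e m → Gen s k e (j + m)
  pad zero g = g
  pad (suc j) g = alt (pad j g) (never _)

  cast : ∀ {e m n} → m ≡ n → Gen s k e m → Gen s k e n
  cast refl g = g

  SomeGen : ℕ → Set
  SomeGen e = Σ ℕ (Gen s k e)

  alts : ∀ {e} → List (SomeGen e) → SomeGen e
  alts [] = 0 , never 0
  alts ((m , g) ∷ gs) = let n , h = alts gs in
    suc (n + m) , alt (pad n g) (cast (+-comm m n) (pad m h))

  once onceIfNot : ∀ {e} → Cond s e → Fin 9 → SomeGen e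
  once c a = 0 , leaf c a
  onceIfNot c a = 0 , leaf (neg c) a

  binding : ∀ {e} → SomeGen (suc e) → SomeGen e
  binding (m , g) = k + m , bind g

  repeating : ∀ {e} → SomeGen e → SomeGen e
  repeating (m , g) = k + m , rep g

  -- The product with the constant `α` becomes `α` copies of a loop that emits one letter for each
  -- counter value below the variable. The counter takes index `zero`, which shifts the variable to
  -- `suc i`.
  repeat : Affine → Fin 9 → List (SomeGen 4)
  repeat (affine α i β) a =
    replicate α (binding (once (less zero (suc i)) a)) ++ replicate β (once always a)

  pattern code-junk  = zero
  pattern code-push₁ = suc zero
  pattern code-pop₁  = suc (suc zero)
  pattern code-push# = suc (suc (suc zero))
  pattern code-pop#  = suc (suc (suc (suc zero)))
  pattern code-mark  = suc (suc (suc (suc (suc zero))))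
  pattern code-open  = suc (suc (suc (suc (suc (suc zero)))))
  pattern code-close = suc (suc (suc (suc (suc (suc (suc zero))))))

  popGens pushGens : List Affine → List (SomeGen 4)
  popGens [] = []
  popGens (t ∷ ts) = (repeat t code-pop₁ ++ [ once always code-pop# ]) ++ popGens ts
  pushGens [] = []
  pushGens (t ∷ ts) = pushGens ts ++ once always code-push# ∷ repeat t code-push₁

  contentGens : Schema s → List (SomeGen 4)
  contentGens θ = onceIfNot (guard θ) code-junk ∷ popGens (pops θ) ++ pushGens (pushes θ)

  blockGens : Schema s → List (SomeGen 4)
  blockGens θ = once always code-mark ∷ once always code-open ∷
    contentGens θ ++ once always code-mark ∷ once always code-close ∷ []

  instancesGen : Schema s → SomeGen 0
  instancesGen θ = binding (binding (binding (binding (alts (blockGens θ)))))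

  contentsGen : List (Schema s) → SomeGen 0
  contentsGen Θ = repeating (alts (map instancesGen Θ))

  module _ (w : Word s) (b : ℕ) where
    private
      N : ℕ
      N = suc b ^ k

      out′ : ∀ {e} → SomeGen e → Vec ℕ e → List Letter
      out′ (_ , g) = output w b g

      outs : ∀ {e} → List (SomeGen e) → Vec ℕ e → List Letter
      outs gs ρ = concatMap (λ g → out′ g ρ) gs

    output-never : ∀ {e} m (ρ : Vec ℕ e) → output w b (never m) ρ ≡ []
    output-never zero ρ = refl
    output-never (suc m) ρ rewrite output-never m ρ = refl

    output-pad : ∀ {e m} j (g : Gen s k e m) ρ → output w b (pad j g) ρ ≡ output w b g ρ
    output-pad zero g ρ = refl
    output-pad {m = m} (suc j) g ρ rewrite output-pad j g ρ | output-never (j + m) ρ = ++-identityʳ _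

    output-cast : ∀ {e m n} (eq : m ≡ n) (g : Gen s k e m) ρ → output w b (cast eq g) ρ ≡ output w b g ρ
    output-cast refl g ρ = refl

    output-alts : ∀ {e} (gs : List (SomeGen e)) ρ → out′ (alts gs) ρ ≡ outs gs ρ
    output-alts [] ρ = refl
    output-alts ((m , g) ∷ gs) ρ = let n , h = alts gs in
      cong₂ _++_ (output-pad n g ρ)
        (trans (output-cast (+-comm m n) (pad m h) ρ) (trans (output-pad m h ρ) (output-alts gs ρ)))

    outs-++ : ∀ {e} (gs hs : List (SomeGen e)) ρ → outs (gs ++ hs) ρ ≡ outs gs ρ ++ outs hs ρ
    outs-++ gs hs ρ = concatMap-++ _ gs hs

    module _ (xs : Vec ℕ 4) (xs< : ∀ i → lookupᵛ xs i < N) where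
      replicate-+ : ∀ m n (a : Letter) → replicate m a ++ replicate n a ≡ replicate (m + n) a
      replicate-+ zero n a = refl
      replicate-+ (suc m) n a = cong (a ∷_) (replicate-+ m n a)

      loop-< : ∀ n x (a : Letter) → x ≤ n → loop (λ y → if y <ᵇ x then [ a ] else []) n ≡ replicate x a
      loop-< zero zero a _ = refl
      loop-< (suc n) zero a _ = loop-< n zero a z≤n
      loop-< (suc n) (suc x) a (s≤s p) = cong (a ∷_) (loop-< n x a p)

      outs-replicate-once : ∀ β a → outs (replicate β (once always a)) xs ≡ replicate β (suc a)
      outs-replicate-once zero a = refl
      outs-replicate-once (suc β) a = cong (suc a ∷_) (outs-replicate-once β a)

      outs-replicate-var : ∀ α i a →
        outs (replicate α (binding (once (less zero (suc i)) a))) xs ≡ replicate (α * lookupᵛ xs i) (suc a)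
      outs-replicate-var zero i a = refl
      outs-replicate-var (suc α) i a = trans
        (cong₂ _++_ (loop-< N (lookupᵛ xs i) (suc a) (<⇒≤ (xs< i))) (outs-replicate-var α i a))
        (replicate-+ (lookupᵛ xs i) (α * lookupᵛ xs i) (suc a))

      outs-repeat : ∀ t a → outs (repeat t a) xs ≡ replicate (⟦ t ⟧ᵃ xs) (suc a)
      outs-repeat (affine α i β) a = trans
        (outs-++ (replicate α (binding (once (less zero (suc i)) a))) (replicate β (once always a)) xs)
        (trans (cong₂ _++_ (outs-replicate-var α i a) (outs-replicate-once β a))
          (replicate-+ (α * lookupᵛ xs i) β (suc a)))

      outs-popGens : ∀ ts → outs (popGens ts) xs ≡ popAll (values ts xs)
      outs-popGens [] = refl
      outs-popGens (t ∷ ts) = trans (outs-++ (repeat t code-pop₁ ++ [ once always code-pop# ]) (popGens ts) xs)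
        (cong₂ _++_ (trans (outs-++ (repeat t code-pop₁) _ xs) (cong (_++ [ pop# ]) (outs-repeat t code-pop₁)))
          (outs-popGens ts))

      outs-pushGens : ∀ ts → outs (pushGens ts) xs ≡ pushAll (values ts xs)
      outs-pushGens [] = refl
      outs-pushGens (t ∷ ts) = trans (outs-++ (pushGens ts) _ xs)
        (cong₂ _++_ (outs-pushGens ts) (cong (push# ∷_) (outs-repeat t code-push₁)))

      outs-contentGens : ∀ θ → outs (contentGens θ) xs ≡ content w θ xs
      outs-contentGens θ = cong₂ _++_ (swap (holds w xs (guard θ)))
        (trans (outs-++ (popGens (pops θ)) _ xs) (cong₂ _++_ (outs-popGens (pops θ)) (outs-pushGens (pushes θ))))
        where
        swap : ∀ c → (if not c then [ junk ] else []) ≡ (if c then [] else [ junk ])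
        swap true = refl
        swap false = refl

      output-block : ∀ θ → out′ (alts (blockGens θ)) xs ≡ blocks [ content w θ xs ]
      output-block θ = trans (output-alts (blockGens θ) xs) (cong (λ l → mark ∷ open' ∷ l)
        (trans (outs-++ (contentGens θ) _ xs) (cong (_++ mark ∷ close ∷ []) (outs-contentGens θ))))

    output-instancesGen : ∀ θ → out′ (instancesGen θ) [] ≡ blocks (instances w N θ)
    output-instancesGen θ = pull λ x₃ p₃ → pull λ x₂ p₂ → pull λ x₁ p₁ → pull λ x₀ p₀ →
      output-block (x₀ ∷ x₁ ∷ x₂ ∷ x₃ ∷ [])
        (λ { zero → p₀ ; (suc zero) → p₁ ; (suc (suc zero)) → p₂ ; (suc (suc (suc zero))) → p₃ }) θ
      where
      pull : ∀ {f g} → (∀ x → x < N → f x ≡ blocks (g x)) → loop f N ≡ blocks (loop g N)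
      pull {g = g} h = trans (loop-cong-< N h) (sym (blocks-loop g N))

    output-contentsGen : ∀ Θ → out′ (contentsGen Θ) [] ≡ blocks (contents w N Θ)
    output-contentsGen Θ = trans
      (loop-cong (λ _ → trans (output-alts (map instancesGen Θ) []) (all Θ)) N)
      (sym (blocks-loop _ N))
      where
      all : ∀ Θ → outs (map instancesGen Θ) [] ≡ blocks (concatMap (instances w N) Θ)
      all [] = refl
      all (θ ∷ Θ) = trans (cong₂ _++_ (output-instancesGen θ) (all Θ)) (sym (blocks-++ (instances w N θ) _))

-- Machine configurations as numbers

constant : ℕ → Affine
constant n = affine 0 zero n

-- Variable 0 names the letter at position x + 1. The right endmarker has no letter of its own and
-- is named through the last letter, hence x + 2.
position : ∀ {s} → InSym s → Affine
position lend = constant 0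
position (letter a) = affine 1 zero 1
position rend = affine 1 zero 2

position-guard : ∀ {s} → InSym s → Cond s 4
position-guard lend = always
position-guard (letter a) = letterAt a zero
position-guard rend = lastAt zero

moved-position : ∀ {s} → InSym s → Move → Affine
moved-position lend right = constant 1
moved-position lend _ = constant 0
moved-position (letter a) left = affine 1 zero 0
moved-position (letter a) stay = affine 1 zero 1
moved-position (letter a) right = affine 1 zero 2
moved-position rend left = affine 1 zero 1
moved-position rend _ = affine 1 zero 2

private
  ≡ᵇ-refl : ∀ n → (n ≡ᵇ n) ≡ true
  ≡ᵇ-refl n = dec-true (n ≟ℕ n) refl

  readAt-letter : ∀ {s} (w : Word s) i {a} → isLetter a (readAt w (suc i)) ≡ true →
    readAt w (suc i) ≡ letter a × i < length w
  readAt-letter (x ∷ w) zero {a} e with x ≟ a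
  ... | yes refl = refl , s≤s z≤n
  readAt-letter (x ∷ w) zero {a} () | no _
  readAt-letter (x ∷ w) (suc i) e = let p , q = readAt-letter w i e in p , s≤s q

  moveIn-right : ∀ {n i} → i ≤ n → moveIn n right i ≡ suc i
  moveIn-right {n} {i} p rewrite dec-true (i ≤? n) p = refl

  moveIn-end : ∀ n → moveIn n right (suc n) ≡ suc n
  moveIn-end n rewrite <ᵇ-false {n} {n} (<-irrefl refl) = refl

  +0 : ∀ x β → x + 0 + β ≡ β + x
  +0 x β rewrite +-identityʳ x = +-comm x β

position-sound : ∀ {s} (w : Word s) σ mv xs → holds w xs (position-guard σ) ≡ true →
  readAt w (⟦ position σ ⟧ᵃ xs) ≡ σ ×
  moveIn (length w) mv (⟦ position σ ⟧ᵃ xs) ≡ ⟦ moved-position σ mv ⟧ᵃ xs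
position-sound w lend left xs _ = refl , refl
position-sound w lend stay xs _ = refl , refl
position-sound w lend right xs _ = refl , refl
position-sound w (letter a) mv xs@(x ∷ _) h rewrite +0 x 1 with readAt-letter w x h
... | e , lt = e , moves mv
  where
  moves : ∀ mv → moveIn (length w) mv (suc x) ≡ ⟦ moved-position (letter a) mv ⟧ᵃ xs
  moves left = sym (+0 x 0)
  moves stay = sym (+0 x 1)
  moves right = trans (moveIn-right lt) (sym (+0 x 2))
position-sound w rend mv xs@(x ∷ _) h rewrite +0 x 2 = readAt-beyond w (s≤s (≤-reflexive (sym eq))) , moves mv
  where
  eq : suc x ≡ length w
  eq = ≡ᵇ⇒≡ (suc x) (length w) (subst T (sym h) _)
  moves : ∀ mv → moveIn (length w) mv (suc (suc x)) ≡ ⟦ moved-position (rend {_}) mv ⟧ᵃ xs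
  moves left = sym (+0 x 1)
  moves stay = sym (+0 x 2)
  moves right = trans (subst (λ n → moveIn n right (suc (suc x)) ≡ suc (suc x)) eq (moveIn-end (suc x))) (sym (+0 x 2))

-- The word must have a last letter for the right endmarker to be named through it.
position-complete : ∀ {s} (w : Word s) → w ≢ [] → ∀ i → i ≤ suc (length w) →
  ∃[ x ] (x ≤ length w × ∀ ys → holds w (x ∷ ys) (position-guard (readAt w i)) ≡ true ×
                                ⟦ position (readAt w i) ⟧ᵃ (x ∷ ys) ≡ i)
position-complete w _ zero _ = 0 , z≤n , λ _ → refl , refl
position-complete {s} w ne (suc i) (s≤s p) with i <? length w
... | yes lt = i , p , λ ys → within w i lt ys
  where
  within : ∀ (w : Word s) i → i < length w → ∀ ys →
    holds w (i ∷ ys) (position-guard (readAt w (suc i))) ≡ true × ⟦ position (readAt w (suc i)) ⟧ᵃ (i ∷ ys) ≡ suc i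
  within w i lt ys with readAt w (suc i) in eq
  ... | letter a rewrite eq | ⌊⌋-yes (a ≟ a) refl = refl , +0 i 1
  ... | lend = ⊥-elim (not-lend w i eq)
    where
    not-lend : ∀ (w : Word s) i → readAt w (suc i) ≢ lend
    not-lend [] i ()
    not-lend (x ∷ w) (suc i) = not-lend w i
  ... | rend = ⊥-elim (not-rend w i lt eq)
    where
    not-rend : ∀ (w : Word s) i → i < length w → readAt w (suc i) ≢ rend
    not-rend (x ∷ w) (suc i) (s≤s lt) = not-rend w i lt
... | no ≮ with w
... | [] = ⊥-elim (ne refl)
... | a ∷ v with ≤-antisym p (≮⇒≥ ≮)
... | refl = length v , n≤1+n _ , λ ys → end ys
  where
  end : ∀ ys → holds (a ∷ v) (length v ∷ ys) (position-guard (readAt v (suc (length v)))) ≡ true ×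
    ⟦ position (readAt v (suc (length v))) ⟧ᵃ (length v ∷ ys) ≡ suc (suc (length v))
  end ys rewrite readAt-beyond v (≤-refl {suc (length v)}) = ≡ᵇ-refl (length v) , +0 (length v) 2

moveIn-≤ : ∀ n mv {i} → i ≤ suc n → moveIn n mv i ≤ suc n
moveIn-≤ n left {zero} p = z≤n
moveIn-≤ n left {suc i} p = ≤-trans (n≤1+n i) p
moveIn-≤ n stay p = p
moveIn-≤ n right {i} p with i ≤ᵇ n in eq
... | true = s≤s (≤ᵇ⇒≤ i n (subst T (sym eq) _))
... | false = p

digit-unique : ∀ {b d e} x y → d < b → e < b → b * x + d ≡ b * y + e → x ≡ y × d ≡ e
digit-unique {b} zero zero p q eq rewrite *-zeroʳ b = refl , eq
digit-unique {b} {d} {e} zero (suc y) p q eq rewrite *-zeroʳ b | *-suc b y | +-assoc b (b * y) e =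
  ⊥-elim (<⇒≱ p (≤-trans (m≤m+n b _) (≤-reflexive (sym eq))))
digit-unique {b} {d} {e} (suc x) zero p q eq rewrite *-zeroʳ b | *-suc b x | +-assoc b (b * x) d =
  ⊥-elim (<⇒≱ q (≤-trans (m≤m+n b _) (≤-reflexive eq)))
digit-unique {b} {d} {e} (suc x) (suc y) p q eq
  rewrite *-suc b x | *-suc b y | +-assoc b (b * x) d | +-assoc b (b * y) e =
  let r , t = digit-unique x y p q (+-cancelˡ-≡ b _ _ eq) in cong suc r , t

-- Work tapes as pairs of numbers.

module Tape (γ : ℕ) where
  -- At least 2 even for a one-letter tape alphabet: in base 1 the number `below` would then always
  -- be 1 and forget the head position.
  base : ℕ
  base = suc (suc γ)

  Tape : Set
  Tape = ℕ → Fin (suc γ)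

  -- Digits below the head, most recent first; the leading 1 marks the left end of the tape.
  below : Tape → ℕ → ℕ
  below t zero = 1
  below t (suc p) = base * below t p + toℕ (t p)

  -- The cell under the head is the least significant digit. The last argument counts the cells
  -- read; codes of configurations take those up to cell `B`.
  above : Tape → ℕ → ℕ → ℕ
  above t p zero = 0
  above t p (suc m) = base * above t (suc p) m + toℕ (t p)

  below-cong : ∀ {t t′} p → (∀ j → j < p → t′ j ≡ t j) → below t′ p ≡ below t p
  below-cong zero h = refl
  below-cong (suc p) h = cong₂ (λ x y → base * x + toℕ y) (below-cong p (λ j q → h j (m<n⇒m<1+n q))) (h p ≤-refl)

  above-cong : ∀ {t t′} p m → (∀ j → p ≤ j → t′ j ≡ t j) → above t′ p m ≡ above t p m
  above-cong p zero h = refl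
  above-cong p (suc m) h = cong₂ (λ x y → base * x + toℕ y) (above-cong (suc p) m (λ j q → h j (<⇒≤ q))) (h p ≤-refl)

  below-pos : ∀ t p → 1 ≤ below t p
  below-pos t zero = s≤s z≤n
  below-pos t (suc p) = ≤-trans (below-pos t p) (≤-trans (m≤m+n _ _) (m≤m+n _ _))

  digit-< : ∀ (d : Fin (suc γ)) → toℕ d < base
  digit-< d = m<n⇒m<1+n (toℕ<n d)

  below-< : ∀ t p → suc (below t p) ≤ base ^ suc p
  below-< t zero = s≤s (s≤s z≤n)
  below-< t (suc p) = begin
    suc (base * below t p + toℕ (t p)) ≡⟨ +-suc (base * below t p) (toℕ (t p)) ⟨
    base * below t p + suc (toℕ (t p)) ≤⟨ +-monoʳ-≤ (base * below t p) (digit-< (t p)) ⟩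
    base * below t p + base            ≡⟨ +-comm (base * below t p) base ⟩
    base + base * below t p            ≡⟨ *-suc base (below t p) ⟨
    base * suc (below t p)             ≤⟨ *-monoʳ-≤ base (below-< t p) ⟩
    base ^ suc (suc p)                 ∎
    where open ≤-Reasoning

  above-< : ∀ t p m → suc (above t p m) ≤ base ^ m
  above-< t p zero = s≤s z≤n
  above-< t p (suc m) = begin
    suc (base * above t (suc p) m + toℕ (t p)) ≡⟨ +-suc (base * above t (suc p) m) (toℕ (t p)) ⟨
    base * above t (suc p) m + suc (toℕ (t p)) ≤⟨ +-monoʳ-≤ (base * above t (suc p) m) (digit-< (t p)) ⟩
    base * above t (suc p) m + base            ≡⟨ +-comm (base * above t (suc p) m) base ⟩
    base + base * above t (suc p) m            ≡⟨ *-suc base (above t (suc p) m) ⟨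
    base * suc (above t (suc p) m)             ≤⟨ *-monoʳ-≤ base (above-< t (suc p) m) ⟩
    base ^ suc m                               ∎
    where open ≤-Reasoning

  -- A left move splits off the digit `d` next to the head. The popped number is `base` · (y + 1) +
  -- d: a positive quotient keeps the leading 1 from being taken for a digit. `nothing` stands for
  -- the head at cell 0, where `moveW` leaves it.
  popped-below : Move → Maybe (Fin (suc γ)) → Affine
  popped-below left nothing = constant 1
  popped-below left (just d) = affine base (suc zero) (base + toℕ d)
  popped-below _ _ = affine 1 (suc zero) 0

  pushed-below pushed-above : Move → Fin (suc γ) → Maybe (Fin (suc γ)) → Affine
  pushed-below left _ nothing = constant 1
  pushed-below left _ (just d) = affine 1 (suc zero) 1
  pushed-below stay _ _ = affine 1 (suc zero) 0
  pushed-below right a _ = affine base (suc zero) (toℕ a)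

  -- This is `base` · (`base` · z + a) + d: the head now stands on `d`, and the written `a` is the
  -- next cell.
  pushed-above left a (just d) = affine (base * base) (suc (suc zero)) (base * toℕ a + toℕ d)
  pushed-above right _ _ = affine 1 (suc (suc zero)) 0
  pushed-above _ a _ = affine base (suc (suc zero)) (toℕ a)

  popped-above : Fin (suc γ) → Affine
  popped-above a = affine base (suc (suc zero)) (toℕ a)

  private
    +0+0 : ∀ x → x + 0 + 0 ≡ x
    +0+0 x = trans (+-identityʳ _) (+-identityʳ x)

    next-digit : ∀ y d → base * y + (base + d) ≡ base * suc y + d
    next-digit y d = begin
      base * y + (base + d) ≡⟨ +-assoc (base * y) base d ⟨
      base * y + base + d   ≡⟨ cong (_+ d) (+-comm (base * y) base) ⟩
      base + base * y + d   ≡⟨ cong (_+ d) (*-suc base y) ⟨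
      base * suc y + d      ∎
      where open ≡-Reasoning

    two-digits : ∀ c z a d → c * (c * z + a) + d ≡ c * c * z + (c * a + d)
    two-digits = solve-∀

    1<carry : ∀ x d → 1 ≤ x → 1 ≢ base * x + d
    1<carry (suc x) d _ eq rewrite +-suc x (x + γ * suc x) with eq
    ... | ()

  -- The digit `ld` to the left of the head is only guessed. The popped number refutes a wrong
  -- guess, so the pushed numbers describe the true successor tape.
  tape-move : ∀ mv ld x y z u {t t′ p m B} {a} →
    t′ p ≡ a → (∀ j → j ≢ p → t′ j ≡ t j) → suc p + m ≡ B →
    below t p ≡ ⟦ popped-below mv ld ⟧ᵃ (x ∷ y ∷ z ∷ u) → above t (suc p) m ≡ z →
    ∃[ m′ ] (moveW mv p + m′ ≡ B ×
             below t′ (moveW mv p) ≡ ⟦ pushed-below mv a ld ⟧ᵃ (x ∷ y ∷ z ∷ u) ×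
             above t′ (moveW mv p) m′ ≡ ⟦ pushed-above mv a ld ⟧ᵃ (x ∷ y ∷ z ∷ u))
  tape-move stay ld x y z u {t} {t′} {p} {m} refl h e e₁ refl =
    suc m , trans (+-suc p m) e , trans (below-cong p (λ j q → h j (<⇒≢ q))) e₁ ,
    cong (λ r → base * r + toℕ (t′ p)) (above-cong (suc p) m (λ j q → h j (>⇒≢ q)))
  tape-move right ld x y z u {t} {t′} {p} {m} refl h e e₁ refl =
    m , e , cong (λ r → base * r + toℕ (t′ p)) (trans (below-cong p (λ j q → h j (<⇒≢ q))) (trans e₁ (+0+0 y))) ,
    trans (above-cong (suc p) m (λ j q → h j (>⇒≢ q))) (sym (+0+0 _))
  tape-move left nothing x y z u {t} {t′} {zero} {m} refl h e e₁ refl =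
    suc m , e , refl ,
    cong (λ r → base * r + toℕ (t′ zero)) (above-cong 1 m (λ j q → h j (>⇒≢ q)))
  tape-move left nothing x y z u {t} {p = suc p} refl h e e₁ refl = ⊥-elim (1<carry _ _ (below-pos t p) (sym e₁))
  tape-move left (just d) x y z u {p = zero} refl h e e₁ refl =
    ⊥-elim (1<carry (suc y) (toℕ d) (s≤s z≤n) (trans e₁ (next-digit y (toℕ d))))
  tape-move left (just d) x y z u {t} {t′} {suc p} {m} refl h e e₁ refl
    with digit-unique (below t p) (suc y) (digit-< (t p)) (digit-< d) (trans e₁ (next-digit y (toℕ d)))
  ... | e₂ , e₃ =
    suc (suc m) , trans (trans (+-suc p (suc m)) (cong suc (+-suc p m))) e ,
    trans (below-cong p (λ j q → h j (<⇒≢ (m<n⇒m<1+n q)))) (trans e₂ (sym (+0 y 1))) ,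
    trans (cong₂ (λ r c → base * (base * r + toℕ (t′ (suc p))) + toℕ c)
            (above-cong (suc (suc p)) m (λ j q → h j (>⇒≢ q)))
            (trans (h p (λ q → 1+n≢n (sym q))) (toℕ-injective e₃)))
      (two-digits base (above t (suc (suc p)) m) (toℕ (t′ (suc p))) (toℕ d))

  popped-below-complete : ∀ mv t p → ∃[ ld ] ∃[ y ] (y ≤ below t p ×
    ∀ x z u → ⟦ popped-below mv ld ⟧ᵃ (x ∷ y ∷ z ∷ u) ≡ below t p)
  popped-below-complete stay t p = nothing , below t p , ≤-refl , λ _ _ _ → +0+0 _
  popped-below-complete right t p = nothing , below t p , ≤-refl , λ _ _ _ → +0+0 _
  popped-below-complete left t zero = nothing , 0 , z≤n , λ _ _ _ → refl
  popped-below-complete left t (suc p) with below t p | below-pos t p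
  ... | suc y | _ = just (t p) , y ,
    ≤-trans (≤-trans (n≤1+n y) (m≤n*m (suc y) base)) (m≤m+n _ _) ,
    λ _ _ _ → next-digit y (toℕ (t p))

-- Runs of a transducer and their codes.

_?∷_ : ∀ {A : Set} → Maybe A → List A → List A
nothing ?∷ l = l
just a ?∷ l = a ∷ l

emitTo-?∷ : ∀ {d} (o : List (Fin d)) x e → emitTo o x ++ e ≡ o ++ (x ?∷ e)
emitTo-?∷ o nothing e = refl
emitTo-?∷ o (just a) e = ++-assoc o [ a ] e

module Machine {s d : ℕ} (M : Transducer s d) where
  open Transducer M
  open Tape γ

  -- The comparison of positions in step is local to Defs, so it is only reachable through step itself.
  tape-step : ∀ w q i t p o {A} j → δ q (readAt w i) (t p) ≡ just A →
    mapᵐ (λ c → Config.tape c j)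
      (step M w (record { state = q ; ipos = i ; tape = t ; wpos = p ; out = o }))
    ≡ just (if j ≡ᵇ p then Action.write A else t j)
  tape-step w q i t p o j eq with δ q (readAt w i) (t p) in eq′
  tape-step w q i t zero o zero refl | just _ = refl
  tape-step w q i t zero o (suc j) refl | just _ = refl
  tape-step w q i t (suc p) o zero refl | just _ = refl
  -- The comparison strips a successor from both arguments, so this is the case of `p` and `j` on
  -- the tape shifted by one cell.
  tape-step w q i t (suc p) o (suc j) refl | just _ with tape-step w q i (t ∘ suc) p o j eq′
  ... | r with δ q (readAt w i) (t (suc p)) | eq′
  ... | just _ | refl = r

  configPops : Fin Q → InSym s → Fin (suc γ) → Affine → List Affine
  configPops q σ a l = constant (suc (toℕ q)) ∷ position σ ∷ l ∷ popped-above a ∷ []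

  configPushes : Action Q (suc γ) d → InSym s → Maybe (Fin (suc γ)) → List Affine
  configPushes A σ ld =
    constant (suc (toℕ (Action.next A))) ∷ moved-position σ (inMove A) ∷
    pushed-below (wMove A) (write A) ld ∷ pushed-above (wMove A) (write A) ld ∷ []
    where open Action using (inMove; write; wMove)

  module Input (w : Word s) (B : ℕ) where
    open Config

    scanned : Config M → Maybe (Action Q (suc γ) d)
    scanned c = δ (state c) (readAt w (ipos c)) (tape c (wpos c))

    record Successor (A : Action Q (suc γ) d) (c c′ : Config M) : Set where
      field
        state≡   : state c′ ≡ Action.next A
        ipos≡    : ipos c′ ≡ moveIn (length w) (Action.inMove A) (ipos c)
        wpos≡    : wpos c′ ≡ moveW (Action.wMove A) (wpos c)
        out≡     : out c′ ≡ emitTo (out c) (Action.emit A)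
        written  : tape c′ (wpos c) ≡ Action.write A
        retained : ∀ j → j ≢ wpos c → tape c′ j ≡ tape c j

    open Successor

    step-nothing : ∀ c → step M w c ≡ nothing → scanned c ≡ nothing
    step-nothing c eq with δ (state c) (readAt w (ipos c)) (tape c (wpos c))
    ... | nothing = refl

    step-tape : ∀ c {c′ A} → step M w c ≡ just c′ → scanned c ≡ just A →
      ∀ j → tape c′ j ≡ (if j ≡ᵇ wpos c then Action.write A else tape c j)
    step-tape c eq eq′ j = just-injective (trans (cong (mapᵐ (λ c → tape c j)) (sym eq))
      (tape-step w (state c) (ipos c) (tape c) (wpos c) (out c) j eq′))

    step-just : ∀ c {c′} → step M w c ≡ just c′ → ∃[ A ] (scanned c ≡ just A × Successor A c c′)
    step-just c {c′} eq = fields (step-tape c eq) eq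
      where
      fields : (∀ {A} → scanned c ≡ just A → ∀ j → tape c′ j ≡ (if j ≡ᵇ wpos c then Action.write A else tape c j)) →
        step M w c ≡ just c′ → ∃[ A ] (scanned c ≡ just A × Successor A c c′)
      fields cell eq with δ (state c) (readAt w (ipos c)) (tape c (wpos c))
      fields cell refl | just A = A , refl , record
        { state≡ = refl ; ipos≡ = refl ; wpos≡ = refl ; out≡ = refl
        ; written = trans (cell refl (wpos c))
            (cong (λ b → if b then Action.write A else tape c (wpos c)) (dec-true (wpos c ≟ℕ wpos c) refl))
        ; retained = λ j ne → trans (cell refl j)
            (cong (λ b → if b then Action.write A else tape c j) (≡ᵇ-false ne)) }

    -- The output still to come replaces the accumulated one, so that a run can be followed letter
    -- by letter along a leftmost derivation.
    data Emits : Config M → List (Fin d) → ℕ → Set where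
      halted : ∀ {c} → wpos c ≤ B → scanned c ≡ nothing → Emits c [] 0
      moved  : ∀ {c c′ A e n} → wpos c ≤ B → scanned c ≡ just A → Successor A c c′ →
               Emits c′ e n → Emits c (Action.emit A ?∷ e) (suc n)

    RunsTo⇒Emits : ∀ {c o} → RunsTo M w B c o → ∃[ e ] ∃[ n ] (Emits c e n × o ≡ out c ++ e)
    RunsTo⇒Emits {c} (halt p eq) = [] , 0 , halted p (step-nothing c eq) , sym (++-identityʳ _)
    RunsTo⇒Emits {c} (next p eq r) with step-just c eq | RunsTo⇒Emits r
    ... | A , eq′ , σ | e , n , ε , refl =
      Action.emit A ?∷ e , suc n , moved p eq′ σ ε ,
      trans (cong (_++ e) (out≡ σ)) (emitTo-?∷ (out c) (Action.emit A) e)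

    Emits-length : ∀ {c e n} → Emits c e n → length e ≤ n
    Emits-length (halted _ _) = z≤n
    Emits-length (moved {A = A} _ _ _ ε) with Action.emit A
    ... | nothing = m≤n⇒m≤1+n (Emits-length ε)
    ... | just _ = s≤s (Emits-length ε)

    Emits-wpos : ∀ {c e n} → Emits c e n → wpos c ≤ B
    Emits-wpos (halted p _) = p
    Emits-wpos (moved p _ _ _) = p

    codeWith : Config M → ℕ → List ℕ
    codeWith c m = suc (toℕ (state c)) ∷ ipos c ∷ below (tape c) (wpos c) ∷ above (tape c) (wpos c) m ∷ []

    -- The cells 0 to `B` are divided between `below` and `above`, so a head move only transfers
    -- digits.
    data Code (c : Config M) : List ℕ → Set where
      code : ∀ m → wpos c + m ≡ suc B → Code c (codeWith c m)

    private
      split-suc : ∀ {p m} → p ≤ B → p + m ≡ suc B → ∃[ m′ ] (m ≡ suc m′ × suc p + m′ ≡ suc B)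
      split-suc {p} {zero} p≤B eq = ⊥-elim (1+n≰n (≤-trans (≤-reflexive (trans (sym eq) (+-identityʳ p))) p≤B))
      split-suc {p} {suc m} p≤B eq = m , refl , trans (sym (+-suc p m)) eq

    -- By uniqueness of digits the numbers on the stack determine state, input symbol and scanned
    -- digit: a block that can be used follows the machine.
    match : ∀ {c S q σ a l} xs → wpos c ≤ B → Code c S → holds w xs (position-guard σ) ≡ true →
      S ≡ values (configPops q σ a l) xs →
      q ≡ state c × σ ≡ readAt w (ipos c) × a ≡ tape c (wpos c) ×
      ipos c ≡ ⟦ position σ ⟧ᵃ xs × below (tape c) (wpos c) ≡ ⟦ l ⟧ᵃ xs ×
      ∃[ m ] (suc (wpos c) + m ≡ suc B × above (tape c) (suc (wpos c)) m ≡ lookupᵛ xs (suc (suc zero)))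
    match {c} {q = q} {σ} {a} xs p (code m e) g eq with split-suc p e
    ... | m′ , refl , e′
      with ∷-injective eq
    ... | e₁ , eq₁ with ∷-injective eq₁
    ... | e₂ , eq₂ with ∷-injective eq₂
    ... | e₃ , eq₃ with digit-unique (above (tape c) (suc (wpos c)) m′) (lookupᵛ xs (suc (suc zero)))
                          (digit-< (tape c (wpos c))) (digit-< a) (∷-injectiveˡ eq₃)
    ... | e₄ , e₅ =
      toℕ-injective (sym (suc-injective e₁)) ,
      trans (sym (proj₁ (position-sound w σ stay xs g))) (cong (readAt w) (sym e₂)) ,
      toℕ-injective (sym e₅) , e₂ , e₃ , m′ , e′ , e₄

    advance : ∀ {c c′ S q σ a A} ld xs → wpos c ≤ B → Code c S → holds w xs (position-guard σ) ≡ true →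
      S ≡ values (configPops q σ a (popped-below (Action.wMove A) ld)) xs → Successor A c c′ →
      Code c′ (values (configPushes A σ ld) xs)
    advance {c} {c′} {σ = σ} {A = A} ld xs@(x ∷ y ∷ z ∷ u) p κ g eq ς
      with match {σ = σ} {l = popped-below (Action.wMove A) ld} xs p κ g eq
    ... | _ , _ , _ , e₂ , e₃ , m , e , e₄
      with tape-move (Action.wMove A) ld x y z u (written ς) (retained ς) e e₃ e₄
    ... | m′ , e₅ , e₆ , e₇ = subst (Code c′)
      (cong₂ _∷_ (cong (suc ∘ toℕ) (state≡ ς))
        (cong₂ _∷_ (trans (ipos≡ ς)
                      (trans (cong (moveIn (length w) (Action.inMove A)) e₂)
                        (proj₂ (position-sound w σ (Action.inMove A) xs g))))
          (cong₂ (λ i j → i ∷ j ∷ []) (trans (cong (below (tape c′)) (wpos≡ ς)) e₆)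
            (trans (cong (λ r → above (tape c′) r m′) (wpos≡ ς)) e₇))))
      (code m′ (trans (cong (_+ m′) (wpos≡ ς)) e₅))

    -- Bounds on codes and on the running time.

    module Bounds (V : ℕ) (Q<V : Q < V) (w<V : suc (length w) < V) (B<V : base ^ suc B ≤ V) where
      below-bound : ∀ t p → p ≤ B → below t p < V
      below-bound t p p≤B = ≤-trans (below-< t p) (≤-trans (^-monoʳ-≤ base (s≤s p≤B)) B<V)

      above-bound : ∀ t p {m} → m ≤ suc B → above t p m < V
      above-bound t p {m} m≤B = ≤-trans (above-< t p m) (≤-trans (^-monoʳ-≤ base m≤B) B<V)

      -- The converse of `match`: a transition for the actual state and symbols can pop the code.
      -- The move is a parameter because only a left move inspects the digit below the head.
      present : ∀ mv {c S} → w ≢ [] → ipos c ≤ suc (length w) → wpos c ≤ B → Code c S →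
        ∃[ ld ] ∃[ xs ] ((∀ i → lookupᵛ xs i < V) ×
          holds w xs (position-guard (readAt w (ipos c))) ≡ true ×
          S ≡ values (configPops (state c) (readAt w (ipos c)) (tape c (wpos c)) (popped-below mv ld)) xs)
      present mv {c} ne i≤ p≤ (code m e)
        with split-suc p≤ e | position-complete w ne (ipos c) i≤ | popped-below-complete mv (tape c) (wpos c)
      ... | m′ , refl , e′ | x , x≤ , h | ld , y , y≤ , h′ =
        ld , x ∷ y ∷ z ∷ 0 ∷ [] , bounded , proj₁ (h _) ,
        cong₂ (λ i j → suc (toℕ (state c)) ∷ i ∷ j ∷ above (tape c) (wpos c) (suc m′) ∷ [])
          (sym (proj₂ (h _))) (sym (h′ x z (0 ∷ [])))
        where
        z : ℕ
        z = above (tape c) (suc (wpos c)) m′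
        m′≤ : m′ ≤ suc B
        m′≤ = ≤-trans (m≤n+m m′ (suc (wpos c))) (≤-reflexive e′)
        bounded : ∀ i → lookupᵛ (x ∷ y ∷ z ∷ 0 ∷ []) i < V
        bounded zero = ≤-trans (s≤s (m≤n⇒m≤1+n x≤)) w<V
        bounded (suc zero) = ≤-trans (s≤s y≤) (below-bound (tape c) (wpos c) p≤)
        bounded (suc (suc zero)) = above-bound (tape c) (suc (wpos c)) m′≤
        bounded (suc (suc (suc zero))) = ≤-trans (s≤s z≤n) Q<V

      ipos-successor : ∀ {A c c′} → Successor A c c′ → ipos c ≤ suc (length w) → ipos c′ ≤ suc (length w)
      ipos-successor {A} ς p = ≤-trans (≤-reflexive (ipos≡ ς)) (moveIn-≤ (length w) (Action.inMove A) p)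

      same-scanned : ∀ mv {c c₁ S} → w ≢ [] → ipos c ≤ suc (length w) → wpos c ≤ B → wpos c₁ ≤ B →
        Code c S → Code c₁ S → scanned c ≡ scanned c₁
      same-scanned mv {c} ne i≤ p p₁ κ κ₁ with present mv {c} ne i≤ p κ
      ... | ld , xs , _ , g , e
        with match {σ = readAt w (ipos c)} {l = popped-below mv ld} xs p₁ κ₁ g e
      ... | e₁ , e₂ , e₃ , _ = cong₃ e₁ e₂ e₃
        where
        cong₃ : ∀ {q q′ σ σ′ a a′} → q ≡ q′ → σ ≡ σ′ → a ≡ a′ → δ q σ a ≡ δ q′ σ′ a′
        cong₃ refl refl refl = refl

      -- Configurations with the same code may differ, in accumulated output or in cells outside the
      -- code, but determinism gives them equally many remaining steps.
      same-length : w ≢ [] → ∀ {c c₁ S e e₁ n n₁} → ipos c ≤ suc (length w) → Code c S → Code c₁ S →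
        Emits c e n → Emits c₁ e₁ n₁ → n ≡ n₁
      same-length ne i≤ κ κ₁ (halted p eq) (halted p₁ eq₁) = refl
      same-length ne i≤ κ κ₁ (halted p eq) (moved p₁ eq₁ ς₁ ε₁)
        with trans (sym eq) (trans (same-scanned stay ne i≤ p p₁ κ κ₁) eq₁)
      ... | ()
      same-length ne i≤ κ κ₁ (moved p eq ς ε) (halted p₁ eq₁)
        with trans (sym eq) (trans (same-scanned stay ne i≤ p p₁ κ κ₁) eq₁)
      ... | ()
      same-length ne {c} i≤ κ κ₁ (moved {A = A} p eq ς ε) (moved p₁ eq₁ ς₁ ε₁)
        with trans (sym eq) (trans (same-scanned stay ne i≤ p p₁ κ κ₁) eq₁)
      ... | refl with present (Action.wMove A) {c} ne i≤ p κ
      ... | ld , xs , _ , g , e = cong suc (same-length ne (ipos-successor ς i≤)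
        (advance {σ = readAt w (ipos c)} ld xs p κ g e ς)
        (advance {σ = readAt w (ipos c)} ld xs p₁ κ₁ g e ς₁) ε ε₁)

      private
        state-bound : ∀ (c : Config M) → toℕ (state c) < V
        state-bound c = ≤-trans (toℕ<n (state c)) (<⇒≤ Q<V)

        ipos-bound : ∀ {i} → i ≤ suc (length w) → i < V
        ipos-bound i≤ = ≤-trans (s≤s i≤) w<V

        rest-bound : ∀ (c : Config M) → above (tape c) (wpos c) (suc B ∸ wpos c) < V
        rest-bound c = above-bound (tape c) (wpos c) (m∸n≤m (suc B) (wpos c))

        pair : ∀ {m a b} → a < m → b < m → Fin (m * m)
        pair p q = combine (fromℕ< p) (fromℕ< q)

        pair-injective : ∀ {m a b c d} (p : a < m) (q : b < m) (p′ : c < m) (q′ : d < m) →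
          pair p q ≡ pair p′ q′ → a ≡ c × b ≡ d
        pair-injective p q p′ q′ eq =
          let e , e′ = combine-injective (fromℕ< p) (fromℕ< q) (fromℕ< p′) (fromℕ< q′) eq
          in fromℕ<-injective _ _ p p′ e , fromℕ<-injective _ _ q q′ e′

      index : ∀ c → ipos c ≤ suc (length w) → wpos c ≤ B → Fin ((V * V) * (V * V))
      index c i≤ p≤ = combine (pair (state-bound c) (ipos-bound i≤)) (pair (below-bound (tape c) (wpos c) p≤) (rest-bound c))

      index-injective : ∀ c c₁ i≤ p≤ i≤₁ p≤₁ → index c i≤ p≤ ≡ index c₁ i≤₁ p≤₁ →
        codeWith c (suc B ∸ wpos c) ≡ codeWith c₁ (suc B ∸ wpos c₁)
      index-injective c c₁ i≤ p≤ i≤₁ p≤₁ eq =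
        let e , e′ = combine-injective (pair (state-bound c) (ipos-bound i≤)) (pair (below-bound (tape c) (wpos c) p≤) (rest-bound c))
                       (pair (state-bound c₁) (ipos-bound i≤₁)) (pair (below-bound (tape c₁) (wpos c₁) p≤₁) (rest-bound c₁)) eq
            e₁ , e₂ = pair-injective (state-bound c) (ipos-bound i≤) (state-bound c₁) (ipos-bound i≤₁) e
            e₃ , e₄ = pair-injective (below-bound (tape c) (wpos c) p≤) (rest-bound c) (below-bound (tape c₁) (wpos c₁) p≤₁) (rest-bound c₁) e′
        in cong₂ _∷_ (cong suc e₁) (cong₂ _∷_ e₂ (cong₂ (λ i j → i ∷ j ∷ []) e₃ e₄))

      record Suffix (n i : ℕ) : Set where
        field
          config    : Config M
          emitted   : List (Fin d)
          remaining : ℕ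
          emits     : Emits config emitted remaining
          in-range  : ipos config ≤ suc (length w)
          total     : remaining + i ≡ n

      suffix : ∀ {c e n} → ipos c ≤ suc (length w) → Emits c e n → (i : Fin (suc n)) → Suffix n (toℕ i)
      suffix i≤ ε zero = record { emits = ε ; in-range = i≤ ; total = +-identityʳ _ }
      suffix i≤ (moved p eq ς ε) (suc i) with suffix (ipos-successor ς i≤) ε i
      ... | record { emits = ε′ ; in-range = i≤′ ; total = t } =
        record { emits = ε′ ; in-range = i≤′ ; total = trans (+-suc _ _) (cong suc t) }

      -- Pigeonhole: moments of the run with the same code have equally many steps left and hence
      -- coincide, and four numbers below `V` form `V` to the fourth power codes.
      running-time : w ≢ [] → ∀ {c e n} → ipos c ≤ suc (length w) → Emits c e n → n < (V * V) * (V * V)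
      running-time ne {c} {e} {n} i≤ ε = injective⇒≤ {f = at} at-injective
        where
        open Suffix
        s[_] : (i : Fin (suc n)) → Suffix n (toℕ i)
        s[_] = suffix i≤ ε
        at : Fin (suc n) → Fin ((V * V) * (V * V))
        at i = index (config s[ i ]) (in-range s[ i ]) (Emits-wpos (emits s[ i ]))
        coded : ∀ i → Code (config s[ i ]) (codeWith (config s[ i ]) (suc B ∸ wpos (config s[ i ])))
        coded i = code _ (m+[n∸m]≡n (m≤n⇒m≤1+n (Emits-wpos (emits s[ i ]))))
        at-injective : ∀ {i j} → at i ≡ at j → i ≡ j
        at-injective {i} {j} eq = toℕ-injective (+-cancelˡ-≡ (remaining s[ i ]) _ _
          (trans (total s[ i ]) (trans (sym (total s[ j ])) (cong (_+ toℕ j) (sym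
            (same-length ne (in-range s[ i ]) (coded i)
              (subst (Code (config s[ j ])) (sym (index-injective (config s[ i ]) (config s[ j ])
                (in-range s[ i ]) (Emits-wpos (emits s[ i ])) (in-range s[ j ]) (Emits-wpos (emits s[ j ])) eq)) (coded j))
              (emits s[ i ]) (emits s[ j ])))))))

-- Leftmost derivations of polynomial length

─-∉ : ∀ {n} {p q : Subset n} {x} → x ∈ₛ p ─ q → x ∉ q
─-∉ {p = inside ∷ p} {outside ∷ q} here ()
─-∉ {p = _ ∷ p} {outside ∷ q} (there x∈) (there x∈q) = ─-∉ {p = p} x∈ x∈q
─-∉ {p = _ ∷ p} {inside ∷ q} (there x∈) (there x∈q) = ─-∉ {p = p} x∈ x∈q

─-monoˡ : ∀ {n} {p q : Subset n} r → p ⊆ q → p ─ r ⊆ q ─ r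
─-monoˡ {p = p} r p⊆q x∈ = x∈p∧x∉q⇒x∈p─q (p⊆q (p─q⊆p p r x∈)) (─-∉ {p = p} x∈)

module Grammar {d : ℕ} (Γ : CFG d) where
  open CFG Γ

  Sentence : Set
  Sentence = List (Fin N ⊎ Fin d)

  data Leftmost : Sentence → Word d → ℕ → Set where
    empty  : Leftmost [] [] 0
    shift  : ∀ {a r u z} → Leftmost r u z → Leftmost (inj₂ a ∷ r) (a ∷ u) z
    expand : ∀ {A rhs r u z} → (A , rhs) ∈ rules → Leftmost (rhs ++ r) u z → Leftmost (inj₁ A ∷ r) u (suc z)

  DerivesSeq-++⁻ : ∀ r {r′ u} → DerivesSeq Γ (r ++ r′) u →
    ∃[ v ] ∃[ v′ ] (u ≡ v ++ v′ × DerivesSeq Γ r v × DerivesSeq Γ r′ v′)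
  DerivesSeq-++⁻ [] D = [] , _ , refl , nil , D
  DerivesSeq-++⁻ (_ ∷ r) (term D) with DerivesSeq-++⁻ r D
  ... | v , v′ , refl , E , E′ = _ , v′ , refl , term E , E′
  DerivesSeq-++⁻ (_ ∷ r) (nont {u = u} C D) with DerivesSeq-++⁻ r D
  ... | v , v′ , refl , E , E′ = u ++ v , v′ , sym (++-assoc u v v′) , nont C E , E′

  Leftmost⇒DerivesSeq : ∀ {r u z} → Leftmost r u z → DerivesSeq Γ r u
  Leftmost⇒DerivesSeq empty = nil
  Leftmost⇒DerivesSeq (shift D) = term (Leftmost⇒DerivesSeq D)
  Leftmost⇒DerivesSeq (expand {rhs = rhs} ρ D) with DerivesSeq-++⁻ rhs (Leftmost⇒DerivesSeq D)
  ... | v , v′ , refl , E , E′ = nont (rule ρ E) E′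

  Leftmost⇒Derives : ∀ {A u z} → Leftmost [ inj₁ A ] u z → Derives Γ A u
  Leftmost⇒Derives D with Leftmost⇒DerivesSeq D
  ... | nont {u = u} C nil = subst (Derives Γ _) (sym (++-identityʳ u)) C

  -- Derivation trees in which no nonterminal is repeated along a path of constant yield:
  -- U is the set of the nonterminals still allowed as long as the yield stays the same.
  mutual
    data Reduced (U : Subset N) : Fin N → Word d → Set where
      node : ∀ {A rhs u} → A ∈ₛ U → (A , rhs) ∈ rules → ReducedSeq (U - A) (length u) rhs u → Reduced U A u

    data ReducedSeq (U : Subset N) (ℓ : ℕ) : Sentence → Word d → Set where
      nil     : ReducedSeq U ℓ [] []
      term    : ∀ {a r u} → ReducedSeq U ℓ r u → ReducedSeq U ℓ (inj₂ a ∷ r) (a ∷ u)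
      full    : ∀ {B r u v} → length u ≡ ℓ → Reduced U B u → ReducedSeq U ℓ r v →
                ReducedSeq U ℓ (inj₁ B ∷ r) (u ++ v)
      shorter : ∀ {B r u v} → length u < ℓ → Reduced ⊤ₛ B u → ReducedSeq U ℓ r v →
                ReducedSeq U ℓ (inj₁ B ∷ r) (u ++ v)

  mutual
    weaken : ∀ {U U′ A u} → U ⊆ U′ → Reduced U A u → Reduced U′ A u
    weaken {A = A} i (node A∈ ρ D) = node (i A∈) ρ (weakenSeq (─-monoˡ ⁅ A ⁆ i) D)

    weakenSeq : ∀ {U U′ ℓ r u} → U ⊆ U′ → ReducedSeq U ℓ r u → ReducedSeq U′ ℓ r u
    weakenSeq i nil = nil
    weakenSeq i (term D) = term (weakenSeq i D)
    weakenSeq i (full e C D) = full e (weaken i C) (weakenSeq i D)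
    weakenSeq i (shorter l C D) = shorter l C (weakenSeq i D)

  -- A subtree found among the children covers only an infix of their yield. If its length is that
  -- of the yield of the whole tree, the infix is that yield, and the subtree can replace the tree.
  Inner : Fin N → ℕ → Word d → Set
  Inner A ℓ v = ∃[ x ] ∃[ u ] ∃[ y ] (v ≡ x ++ u ++ y × length u ≡ ℓ × Reduced ⊤ₛ A u)

  private
    Inner-++ˡ : ∀ {A ℓ} u {v} → Inner A ℓ v → Inner A ℓ (u ++ v)
    Inner-++ˡ u (x , v , y , refl , e , D) = u ++ x , v , y , sym (++-assoc u x (v ++ y)) , e , D

    Inner-total : ∀ {A u} → Inner A (length u) u → Reduced ⊤ₛ A u
    Inner-total {A} (x , u , y , refl , e , D) = subst (Reduced ⊤ₛ A) (whole x y lengths) D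
      where
      lengths : length u ≡ length x + (length u + length y)
      lengths = trans e (trans (length-++ x) (cong (length x +_) (length-++ u)))
      whole : ∀ x y → length u ≡ length x + (length u + length y) → u ≡ x ++ u ++ y
      whole [] [] _ = sym (++-identityʳ u)
      whole [] (b ∷ y) e = ⊥-elim (m≢1+m+n (length u) (trans e (+-suc (length u) (length y))))
      whole (a ∷ x) y e = ⊥-elim (m≢1+m+n (length u) (trans e (cong suc
        (trans (sym (+-assoc (length x) (length u) (length y)))
          (trans (cong (_+ length y) (+-comm (length x) (length u))) (+-assoc (length u) (length x) (length y)))))))

  -- Either A already occurs below with the full yield, and that subtree can replace everything
  -- above it, or A can be forbidden.
  mutual
    remove : ∀ {U B u} A → Reduced U B u → Reduced ⊤ₛ A u ⊎ Reduced (U - A) B u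
    remove {U} {B} A (node B∈ ρ D) with B ≟ A
    ... | yes refl = inj₁ (weaken ⊆⊤ (node B∈ ρ D))
    ... | no B≢A with removeSeq A D
    ... | inj₁ i = inj₁ (Inner-total i)
    ... | inj₂ D′ = inj₂ (node (x∈p∧x≢y⇒x∈p-y B∈ B≢A) ρ
                      (subst (λ W → ReducedSeq W _ _ _) (p─x─y≡p─y─x U B A) D′))

    removeSeq : ∀ {U ℓ r u} A → ReducedSeq U ℓ r u → Inner A ℓ u ⊎ ReducedSeq (U - A) ℓ r u
    removeSeq A nil = inj₂ nil
    removeSeq A (term {a} D) with removeSeq A D
    ... | inj₁ i = inj₁ (Inner-++ˡ [ a ] i)
    ... | inj₂ D′ = inj₂ (term D′)
    removeSeq A (full {u = u} e C D) with remove A C | removeSeq A D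
    ... | inj₁ C′ | _ = inj₁ ([] , u , _ , refl , e , C′)
    ... | inj₂ _  | inj₁ i = inj₁ (Inner-++ˡ u i)
    ... | inj₂ C′ | inj₂ D′ = inj₂ (full e C′ D′)
    -- Below a strictly shorter yield all nonterminals are allowed again, so `C` stays as it is.
    removeSeq A (shorter {u = u} l C D) with removeSeq A D
    ... | inj₁ i = inj₁ (Inner-++ˡ u i)
    ... | inj₂ D′ = inj₂ (shorter l C D′)

  mutual
    reduce : ∀ {A u} → Derives Γ A u → Reduced ⊤ₛ A u
    reduce {A} (rule ρ D) with reduceSeq A ≤-refl D
    ... | inj₁ i = Inner-total i
    ... | inj₂ D′ = node ∈⊤ ρ D′

    reduceSeq : ∀ {ℓ r u} A → length u ≤ ℓ → DerivesSeq Γ r u → Inner A ℓ u ⊎ ReducedSeq (⊤ₛ - A) ℓ r u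
    reduceSeq A p nil = inj₂ nil
    reduceSeq A p (term {a} D) with reduceSeq A (≤-trans (n≤1+n _) p) D
    ... | inj₁ i = inj₁ (Inner-++ˡ [ a ] i)
    ... | inj₂ D′ = inj₂ (term D′)
    reduceSeq {ℓ} A p (nont {u = u} {v} C D)
      with reduceSeq A (≤-trans (≤-trans (m≤n+m (length v) (length u)) (≤-reflexive (sym (length-++ u)))) p) D
    ... | inj₁ i = inj₁ (Inner-++ˡ u i)
    ... | inj₂ D′ with m≤n⇒m<n∨m≡n (≤-trans (≤-trans (m≤m+n (length u) (length v)) (≤-reflexive (sym (length-++ u)))) p)
    ... | inj₁ l = inj₂ (shorter l (reduce C) D′)
    ... | inj₂ e with remove A (reduce C)
    ... | inj₁ C′ = inj₁ ([] , u , v , refl , e , C′)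
    ... | inj₂ C′ = inj₂ (full e C′ D′)

  -- Crude bounds: a reduced tree of empty yield has height at most `N` and branching at most
  -- `width`; `nodeCost` pays for a node together with its children of empty yield.
  width nullCost nodeCost : ℕ
  width = sum (map (length ∘ proj₂) rules)
  nullCost = suc width ^ N
  nodeCost = suc (width * nullCost)

  -- Each of the `m` letters pays for the nodes above it. There are at most `N` of these for each
  -- length of their yield, which `suc N * m + N` generously covers.
  treeCost derivationCost : ℕ → ℕ
  treeCost m = m * ((suc N * m + N) * nodeCost)
  derivationCost m = nullCost + treeCost m

  -- The arbitrary continuation lets the costs of adjacent pieces add up without a concatenation of
  -- leftmost derivations.
  Sized : Sentence → Word d → ℕ → Set
  Sized r u c = ∀ {r′ v z} → Leftmost r′ v z → ∃[ y ] (y ≤ c × Leftmost (r ++ r′) (u ++ v) (y + z))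

  private
    width-bound : ∀ {A rhs} → (A , rhs) ∈ rules → length rhs ≤ width
    width-bound = go rules
      where
      go : ∀ ρs {A rhs} → (A , rhs) ∈ ρs → length rhs ≤ sum (map (length ∘ proj₂) ρs)
      go (_ ∷ ρs) (here refl) = m≤m+n _ _
      go (ρ ∷ ρs) (there p) = ≤-trans (go ρs p) (m≤n+m _ (length (proj₂ ρ)))

    Sized-nil : ∀ {c} → Sized [] [] c
    Sized-nil {c} D = 0 , z≤n , D

    Sized-term : ∀ {a r u c} → Sized r u c → Sized (inj₂ a ∷ r) (a ∷ u) c
    Sized-term S D = let y , p , E = S D in y , p , shift E

    Sized-weaken : ∀ {r u c c′} → c ≤ c′ → Sized r u c → Sized r u c′
    Sized-weaken l S D = let y , p , E = S D in y , ≤-trans p l , E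

    Sized-nont : ∀ {B r u v c c′} → Sized [ inj₁ B ] u c → Sized r v c′ → Sized (inj₁ B ∷ r) (u ++ v) (c + c′)
    Sized-nont {B} {r} {u} {v} S S′ {r′} {v′} {z} D with S′ D
    ... | y′ , p′ , E with S E
    ... | y , p , F = y + y′ , +-mono-≤ p p′ ,
      subst₂ (Leftmost (inj₁ B ∷ r ++ r′)) (sym (++-assoc u v v′)) (sym (+-assoc y y′ z)) F

    Sized-node : ∀ {A rhs u c} → (A , rhs) ∈ rules → Sized rhs u c → Sized [ inj₁ A ] u (suc c)
    Sized-node ρ S D = let y , p , E = S D in suc y , s≤s p , expand ρ E

    null-size : ∀ {U A u} → length u ≡ 0 → Reduced U A u → Sized [ inj₁ A ] u (suc width ^ ∣ U ∣)
    null-sizes : ∀ {U ℓ r u} → ℓ ≡ 0 → ReducedSeq U ℓ r u → length u ≡ 0 →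
      Sized r u (length r * suc width ^ ∣ U ∣)
    null-size {U} {A} {u} e (node {rhs = rhs} A∈ ρ D) = Sized-weaken cost (Sized-node ρ (null-sizes e D e))
      where
      c : ℕ
      c = suc width ^ ∣ U - A ∣
      cost : suc (length rhs * c) ≤ suc width ^ ∣ U ∣
      cost = begin
        suc (length rhs * c)         ≤⟨ +-mono-≤ (m^n>0 (suc width) ∣ U - A ∣) (*-monoˡ-≤ c (width-bound ρ)) ⟩
        suc width ^ suc ∣ U - A ∣    ≤⟨ ^-monoʳ-≤ (suc width) (x∈p⇒∣p-x∣<∣p∣ A∈) ⟩
        suc width ^ ∣ U ∣            ∎
        where open ≤-Reasoning
    null-sizes z nil _ = Sized-nil
    null-sizes z (term D) ()
    null-sizes refl (shorter () _ _) _
    null-sizes refl (full {u = []} e C D) e′ = Sized-nont (null-size e C) (null-sizes refl D e′)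

    null-bound : ∀ {U A u} → length u ≡ 0 → Reduced U A u → Sized [ inj₁ A ] u nullCost
    null-bound {U} e D = Sized-weaken (^-monoʳ-≤ (suc width) (∣p∣≤n U)) (null-size e D)

    interchange : ∀ a b c d → (a + b) + (c + d) ≡ (a + c) + (b + d)
    interchange = solve-∀

    split-cost : ∀ {H} (u : Word d) {v : Word d} (r : Sentence) →
      (nullCost + length u * (H * nodeCost)) + (length r * nullCost + length v * (H * nodeCost))
      ≤ suc (length r) * nullCost + length (u ++ v) * (H * nodeCost)
    split-cost {H} u {v} r rewrite length-++ u {v} | *-distribʳ-+ (H * nodeCost) (length u) (length v) =
      ≤-reflexive (interchange nullCost _ (length r * nullCost) _)

    -- `suc N * length u + ∣ U ∣` is a height measure. A child of equal yield lowers it because `U`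
    -- loses a nonterminal; for a shorter yield the first term drops by at least `suc N`, more than
    -- the reset of `U` can add.
    tree-size : ∀ {U A u} → 0 < length u → Reduced U A u →
      Sized [ inj₁ A ] u (length u * ((suc N * length u + ∣ U ∣) * nodeCost))
    tree-sizes : ∀ {U ℓ r u} H → suc N * ℓ + ∣ U ∣ ≤ H → suc N * ℓ ≤ H → ReducedSeq U ℓ r u →
      Sized r u (length r * nullCost + length u * (H * nodeCost))
    child-size : ∀ {U B u} H → suc N * length u + ∣ U ∣ ≤ H → Reduced U B u →
      Sized [ inj₁ B ] u (nullCost + length u * (H * nodeCost))

    tree-size {U} {A} {u} 0<u (node {rhs = rhs} A∈ ρ D) with ∣ U ∣ | x∈p⇒∣p-x∣<∣p∣ A∈
    ... | suc j | s≤s l = Sized-weaken cost (Sized-node ρ (tree-sizes H (+-monoʳ-≤ (suc N * m) l) (m≤m+n _ j) D))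
      where
      m H : ℕ
      m = length u
      H = suc N * m + j
      cost : suc (length rhs * nullCost + m * (H * nodeCost)) ≤ m * ((suc N * m + suc j) * nodeCost)
      cost = begin
        suc (length rhs * nullCost) + m * (H * nodeCost)
          ≤⟨ +-monoˡ-≤ _ (s≤s (*-monoˡ-≤ nullCost (width-bound ρ))) ⟩
        nodeCost + m * (H * nodeCost)
          ≤⟨ +-monoˡ-≤ _ (m≤n*m nodeCost m {{>-nonZero 0<u}}) ⟩
        m * nodeCost + m * (H * nodeCost)
          ≡⟨ *-distribˡ-+ m nodeCost (H * nodeCost) ⟨
        m * (suc H * nodeCost)
          ≡⟨ cong (λ h → m * (h * nodeCost)) (+-suc (suc N * m) j) ⟨
        m * ((suc N * m + suc j) * nodeCost) ∎
        where open ≤-Reasoning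

    tree-sizes H h h′ nil = Sized-nil
    tree-sizes {r = _ ∷ r} {_ ∷ u} H h h′ (term D) =
      Sized-weaken (+-mono-≤ (m≤n+m _ nullCost) (m≤n+m _ (H * nodeCost))) (Sized-term (tree-sizes H h h′ D))
    tree-sizes H h h′ (full {B} {r} {u} {v} refl C D) =
      Sized-weaken (split-cost {H} u r) (Sized-nont (child-size H h C) (tree-sizes H h h′ D))
    tree-sizes {ℓ = ℓ} H h h′ (shorter {B} {r} {u} {v} l C D) =
      Sized-weaken (split-cost {H} u r) (Sized-nont (child-size H below C) (tree-sizes H h h′ D))
      where
      below : suc N * length u + ∣ ⊤ₛ {N} ∣ ≤ H
      below = begin
        suc N * length u + ∣ ⊤ₛ {N} ∣ ≤⟨ +-monoʳ-≤ (suc N * length u) (m≤n⇒m≤1+n (∣p∣≤n (⊤ₛ {N}))) ⟩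
        suc N * length u + suc N     ≡⟨ +-comm (suc N * length u) (suc N) ⟩
        suc N + suc N * length u     ≡⟨ *-suc (suc N) (length u) ⟨
        suc N * suc (length u)       ≤⟨ *-monoʳ-≤ (suc N) l ⟩
        suc N * ℓ                    ≤⟨ h′ ⟩
        H                            ∎
        where open ≤-Reasoning

    child-size {u = []} H h C = Sized-weaken (m≤m+n nullCost 0) (null-bound refl C)
    child-size {u = u@(_ ∷ _)} H h C = Sized-weaken
      (≤-trans (*-monoʳ-≤ (length u) (*-monoˡ-≤ nodeCost h)) (m≤n+m _ nullCost))
      (tree-size (s≤s z≤n) C)

  Derives⇒Leftmost : ∀ {A u} → Derives Γ A u → ∃[ z ] (z ≤ derivationCost (length u) × Leftmost [ inj₁ A ] u z)
  Derives⇒Leftmost {A} {u} D with child-size (suc N * length u + N) (+-monoʳ-≤ (suc N * length u) (∣p∣≤n (⊤ₛ {N}))) (reduce D) empty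
  ... | y , p , E = y , p , subst₂ (Leftmost [ inj₁ A ]) (++-identityʳ u) (+-identityʳ y) E

-- The rewriting system of a transducer followed by a grammar

module Simulation {s d : ℕ} (M : Transducer s d) (Γ : CFG d) where
  open Transducer M
  open Tape γ
  open Machine M
  open CFG Γ
  open Grammar Γ

  symbol : Fin N ⊎ Fin d → ℕ
  symbol x = suc (toℕ (join N d x))

  symbol-injective : ∀ x y → symbol x ≡ symbol y → x ≡ y
  symbol-injective x y e = trans (sym (splitAt-join N d x)) (trans
    (cong (splitAt N) (toℕ-injective (suc-injective e))) (splitAt-join N d y))

  symbols : Sentence → List Affine
  symbols = map (constant ∘ symbol)

  values-symbols : ∀ r xs → values (symbols r) xs ≡ map symbol r
  values-symbols [] xs = refl
  values-symbols (x ∷ r) xs = cong (symbol x ∷_) (values-symbols r xs)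

  values-++ : ∀ ts us xs → values (ts ++ us) xs ≡ values ts xs ++ values us xs
  values-++ ts us xs = map-++ _ ts us

  emitted : Maybe (Fin d) → Sentence
  emitted x = maybe (λ a → [ inj₂ a ]) [] x

  -- The stack [ 0 ] occurs only at the start: state numbers and symbols are positive, and a 0 at the bottom
  -- marks the end of the pending sentence.
  initial : Schema s
  initial = schema always [ constant 0 ]
    (constant (suc (toℕ q₀)) ∷ constant 0 ∷ constant 1 ∷ constant 0 ∷ constant (symbol (inj₁ start)) ∷ constant 0 ∷ [])

  -- An expansion has to reach the sentence beneath the configuration: it lifts off the four
  -- numbers, whatever they are, and puts them back.
  anyConfig : List Affine
  anyConfig = map (λ i → affine 1 i 0) (allFin 4)

  expansion : Fin N × Sentence → Schema s
  expansion (A , rhs) = schema always (anyConfig ++ [ constant (symbol (inj₁ A)) ]) (anyConfig ++ symbols rhs)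

  -- Emitting a letter means popping it as the next pending terminal. Halting also pops the 0 at the
  -- bottom, which requires that the sentence is exhausted.
  transition : Maybe (Action Q (suc γ) d) → Fin Q → InSym s → Fin (suc γ) → Maybe (Fin (suc γ)) → Schema s
  transition nothing q σ a ld =
    schema (position-guard σ) (configPops q σ a (popped-below stay ld) ++ [ constant 0 ]) []
  transition (just A) q σ a ld =
    schema (position-guard σ)
      (configPops q σ a (popped-below (Action.wMove A) ld) ++ symbols (emitted (Action.emit A)))
      (configPushes A σ ld)

  inputs : List (InSym s)
  inputs = lend ∷ rend ∷ map letter (allFin s)

  digits : List (Maybe (Fin (suc γ)))
  digits = nothing ∷ map just (allFin (suc γ))

  transitionsAt : Fin Q → InSym s → Fin (suc γ) → List (Schema s)
  transitionsAt q σ a = map (transition (δ q σ a) q σ a) digits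

  transitionsOn : Fin Q → InSym s → List (Schema s)
  transitionsOn q σ = concatMap (transitionsAt q σ) (allFin (suc γ))

  transitionsFrom : Fin Q → List (Schema s)
  transitionsFrom q = concatMap (transitionsOn q) inputs

  transitions : List (Schema s)
  transitions = concatMap transitionsFrom (allFin Q)

  schemas : List (Schema s)
  schemas = initial ∷ map expansion rules ++ transitions

  data Origin : Schema s → Set where
    from-initial    : Origin initial
    from-expansion  : ∀ {ρ} → ρ ∈ rules → Origin (expansion ρ)
    from-transition : ∀ q σ a ld → Origin (transition (δ q σ a) q σ a ld)

  private
    All-concatMap : ∀ {A C : Set} {R : C → Set} (f : A → List C) l → (∀ x → All R (f x)) → All R (concatMap f l)
    All-concatMap f [] h = []
    All-concatMap f (x ∷ l) h = All-++⁺ (h x) (All-concatMap f l h)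

    ∈-concatMap : ∀ {A C : Set} (f : A → List C) {l x y} → x ∈ l → y ∈ f x → y ∈ concatMap f l
    ∈-concatMap f p q = ∈-concatMap⁺ f (Any-map (λ { refl → q }) p)

  origin : ∀ {θ} → θ ∈ schemas → Origin θ
  origin = All-lookup (from-initial ∷ All-++⁺ (All-map⁺ (All-tabulate from-expansion))
    (All-concatMap _ (allFin Q) λ q → All-concatMap _ inputs λ σ → All-concatMap _ (allFin (suc γ)) λ a →
      All-map⁺ (All-tabulate {xs = digits} λ {ld} _ → from-transition q σ a ld)))

  expansion∈ : ∀ {ρ} → ρ ∈ rules → expansion ρ ∈ schemas
  expansion∈ p = there (∈-++⁺ˡ (∈-map⁺ expansion p))

  transition∈ : ∀ q σ a ld → transition (δ q σ a) q σ a ld ∈ schemas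
  transition∈ q σ a ld = there (∈-++⁺ʳ (map expansion rules)
    (∈-concatMap transitionsFrom (∈-allFin q) (∈-concatMap (transitionsOn q) (input σ) (∈-concatMap (transitionsAt q σ) (∈-allFin a)
      (∈-map⁺ (transition (δ q σ a) q σ a) (digit ld))))))
    where
    input : ∀ σ → σ ∈ inputs
    input lend = here refl
    input rend = there (here refl)
    input (letter a) = there (there (∈-map⁺ letter (∈-allFin a)))
    digit : ∀ ld → ld ∈ digits
    digit nothing = here refl
    digit (just a) = there (∈-map⁺ just (∈-allFin a))

  module _ (w : Word s) (B : ℕ) where
    open Config
    open Input w B

    frame : List ℕ → Sentence → List ℕ
    frame S r = S ++ map symbol r ++ [ 0 ]

    expanded : ∀ xs rhs r → values (anyConfig ++ symbols rhs) xs ++ map symbol r ++ [ 0 ] ≡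
      frame (values anyConfig xs) (rhs ++ r)
    expanded xs rhs r = begin
      values (anyConfig ++ symbols rhs) xs ++ map symbol r ++ [ 0 ]
        ≡⟨ cong (_++ map symbol r ++ [ 0 ]) (values-++ anyConfig (symbols rhs) xs) ⟩
      (values anyConfig xs ++ values (symbols rhs) xs) ++ map symbol r ++ [ 0 ]
        ≡⟨ ++-assoc (values anyConfig xs) (values (symbols rhs) xs) _ ⟩
      values anyConfig xs ++ values (symbols rhs) xs ++ map symbol r ++ [ 0 ]
        ≡⟨ cong (λ l → values anyConfig xs ++ l ++ map symbol r ++ [ 0 ]) (values-symbols rhs xs) ⟩
      values anyConfig xs ++ map symbol rhs ++ map symbol r ++ [ 0 ]
        ≡⟨ cong (values anyConfig xs ++_) (++-assoc (map symbol rhs) (map symbol r) [ 0 ]) ⟨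
      values anyConfig xs ++ (map symbol rhs ++ map symbol r) ++ [ 0 ]
        ≡⟨ cong (λ l → values anyConfig xs ++ l ++ [ 0 ]) (map-++ symbol rhs r) ⟨
      frame (values anyConfig xs) (rhs ++ r) ∎
      where open ≡-Reasoning

    private
      cut : ∀ {a b c d a′ b′ c′ d′ : ℕ} {X Y : List ℕ} →
        _≡_ {A = List ℕ} (a ∷ b ∷ c ∷ d ∷ X) (a′ ∷ b′ ∷ c′ ∷ d′ ∷ Y) →
        _≡_ {A = List ℕ} (a′ ∷ b′ ∷ c′ ∷ d′ ∷ []) (a ∷ b ∷ c ∷ d ∷ []) × X ≡ Y
      cut refl = refl , refl

      head-symbol : ∀ (r : Sentence) x {Y : List ℕ} → symbol x ∷ Y ≡ map symbol r ++ [ 0 ] →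
        ∃[ r′ ] (r ≡ x ∷ r′ × Y ≡ map symbol r′ ++ [ 0 ])
      head-symbol (y ∷ r) x e with symbol-injective x y (∷-injectiveˡ e)
      ... | refl = r , refl , ∷-injectiveʳ e

      scanned-match : ∀ {c S q σ a l} xs → wpos c ≤ B → Code c S → holds w xs (position-guard σ) ≡ true →
        S ≡ values (configPops q σ a l) xs → scanned c ≡ δ q σ a
      scanned-match {q = q} {σ} {a} {l} xs p κ g e with match {σ = σ} {l = l} xs p κ g e
      ... | refl , refl , refl , _ = refl

    -- Invariant: the stack is the code of the configuration reached, the pending sentence and a 0.
    -- The auxiliary statement takes the value of `δ` as a variable `A`, so that distinguishing
    -- cases on it determines the schema.
    Steps⇒Leftmost : ∀ {n V T S c r e m} → Steps w V schemas T n [] → T ≡ frame S r →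
      Code c S → Emits c e m → ∃[ z ] Leftmost r e z
    transition⇒Leftmost : ∀ {n V T T′ S c r e m} q σ a ld A → δ q σ a ≡ A → ∀ xs U →
      holds w xs (position-guard σ) ≡ true →
      T ≡ values (Schema.pops (transition A q σ a ld)) xs ++ U →
      T′ ≡ values (Schema.pushes (transition A q σ a ld)) xs ++ U →
      Steps w V schemas T′ n [] → T ≡ frame S r → Code c S → Emits c e m → ∃[ z ] Leftmost r e z

    Steps⇒Leftmost stop () (code _ _) ε
    Steps⇒Leftmost (more (apply θ xs U θ∈ b g e₁ e₂) σs) eT κ ε with origin θ∈
    Steps⇒Leftmost (more (apply _ xs U θ∈ b g refl e₂) σs) () (code _ _) ε | from-initial
    Steps⇒Leftmost {r = r} (more (apply _ xs U θ∈ b g refl e₂) σs) eT κ@(code m eq) ε | from-expansion {A , rhs} ρ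
      with cut eT
    ... | eS , e′ with head-symbol r (inj₁ A) {U} e′
    ... | r′ , refl , refl =
      let z , D = Steps⇒Leftmost σs (trans e₂ (expanded xs rhs r′)) (subst (Code _) eS κ) ε in suc z , expand ρ D
    Steps⇒Leftmost (more (apply _ xs U θ∈ b g e₁ e₂) σs) eT κ ε | from-transition q σ a ld =
      transition⇒Leftmost q σ a ld (δ q σ a) refl xs U (guarded (δ q σ a) g) e₁ e₂ σs eT κ ε
      where
      guarded : ∀ A → holds w xs (Schema.guard (transition A q σ a ld)) ≡ true → holds w xs (position-guard σ) ≡ true
      guarded nothing h = h
      guarded (just _) h = h

    transition⇒Leftmost {r = r} q σ a ld nothing eq xs U g refl _ σs eT κ@(code m _) ε with cut eT
    ... | eS , e′ with r | e′ | ε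
    ... | [] | _ | halted _ _ = 0 , empty
    -- Pending symbols have positive numbers, so a popped 0 is the bottom of the stack.
    ... | _ ∷ _ | () | _
    ... | [] | _ | moved p eq′ _ _
      with trans (sym eq′) (trans (scanned-match {l = popped-below stay ld} xs p κ g eS) eq)
    ... | ()
    transition⇒Leftmost q σ a ld (just A) eq xs U g refl e₂ σs eT κ@(code m _) (halted p eq′)
      with trans (sym eq′) (trans (scanned-match {l = popped-below (Action.wMove A) ld} xs p κ g (proj₁ (cut eT))) eq)
    ... | ()
    transition⇒Leftmost {r = r} q σ a ld (just A) eq xs U g refl e₂ σs eT κ@(code m _) (moved p eq′ ς ε) with cut eT
    ... | eS , e′ with trans (sym eq′) (trans (scanned-match {l = popped-below (Action.wMove A) ld} xs p κ g eS) eq)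
    ... | refl = emitting (Action.emit A) e′
      where
      κ′ : Code _ (values (configPushes A σ ld) xs)
      κ′ = advance {σ = σ} ld xs p κ g eS ς
      emitting : ∀ x → values (symbols (emitted x)) xs ++ U ≡ map symbol r ++ [ 0 ] → ∃[ z ] Leftmost r (x ?∷ _) z
      emitting nothing refl = Steps⇒Leftmost σs e₂ κ′ ε
      emitting (just x) e″ with head-symbol r (inj₂ x) {U} e″
      ... | r′ , refl , refl = let z , D = Steps⇒Leftmost σs e₂ κ′ ε in z , shift D

    initConfig-code : Code (initConfig M) (suc (toℕ q₀) ∷ 0 ∷ 1 ∷ 0 ∷ [])
    initConfig-code = subst (λ y → Code (initConfig M) (suc (toℕ q₀) ∷ 0 ∷ 1 ∷ y ∷ [])) (blank 0 (suc B)) (code (suc B) refl)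
      where
      blank : ∀ p m → above (λ _ → zero) p m ≡ 0
      blank p zero = refl
      blank p (suc m) rewrite blank (suc p) m | *-zeroʳ base = refl

    Steps⇒Leftmost-start : ∀ {n V e m} → Steps w V schemas [ 0 ] n [] → Emits (initConfig M) e m →
      ∃[ z ] Leftmost [ inj₁ start ] e z
    Steps⇒Leftmost-start (more (apply θ xs U θ∈ b g e₁ e₂) σs) ε with origin θ∈
    Steps⇒Leftmost-start (more (apply _ xs [] θ∈ b g refl e₂) σs) ε | from-initial =
      Steps⇒Leftmost σs e₂ initConfig-code ε
    Steps⇒Leftmost-start (more (apply _ xs U θ∈ b g () e₂) σs) ε | from-expansion _
    Steps⇒Leftmost-start (more (apply _ xs U θ∈ b g e₁ e₂) σs) ε | from-transition q σ a ld with δ q σ a | e₁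
    ... | nothing | ()
    ... | just _ | ()

    module _ (V : ℕ) (Q<V : Q < V) (w<V : suc (length w) < V) (B<V : base ^ suc B ≤ V)
             (ne : w ≢ []) (K : ℕ) (V≤K : V ≤ K) where
      open Bounds V Q<V w<V B<V

      halting-step : ∀ {c S} → ipos c ≤ suc (length w) → wpos c ≤ B → Code c S → scanned c ≡ nothing →
        Step w K schemas (S ++ [ 0 ]) []
      halting-step {c} {S} i≤ p κ eq with present stay {c} ne i≤ p κ
      ... | ld , xs , b , g , eS =
        apply _ xs [] (subst (λ A → transition A _ _ _ ld ∈ schemas) eq
          (transition∈ (state c) (readAt w (ipos c)) (tape c (wpos c)) ld))
          (λ i → ≤-trans (b i) V≤K) g (cong (_++ [ 0 ]) eS) refl

      moving-step : ∀ {c c′ S A} → ipos c ≤ suc (length w) → wpos c ≤ B → Code c S → scanned c ≡ just A →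
        Successor A c c′ → ∃[ S′ ] (Code c′ S′ ×
          ∀ Z → Step w K schemas (S ++ map symbol (emitted (Action.emit A)) ++ Z) (S′ ++ Z))
      moving-step {c} {S = S} {A} i≤ p κ eq ς with present (Action.wMove A) {c} ne i≤ p κ
      ... | ld , xs , b , g , eS = _ , advance {σ = readAt w (ipos c)} ld xs p κ g eS ς , λ Z →
        apply _ xs Z (subst (λ A → transition A _ _ _ ld ∈ schemas) eq
          (transition∈ (state c) (readAt w (ipos c)) (tape c (wpos c)) ld))
          (λ i → ≤-trans (b i) V≤K) g (cong₂ (λ X Y → X ++ Y ++ Z) eS (sym (values-symbols _ xs))) refl

      expansion-step : ∀ {c S A rhs} → ipos c ≤ suc (length w) → wpos c ≤ B → Code c S → (A , rhs) ∈ rules → ∀ r →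
        Step w K schemas (frame S (inj₁ A ∷ r)) (frame S (rhs ++ r))
      expansion-step {c} {S} {A} {rhs} i≤ p (code m e) ρ r =
        apply _ xs (map symbol r ++ [ 0 ]) (expansion∈ ρ) bounded refl
          (cong (_++ symbol (inj₁ A) ∷ map symbol r ++ [ 0 ]) (sym any)) (trans (cong (λ l → frame l (rhs ++ r)) (sym any)) (sym (expanded xs rhs r)))
        where
        xs : Vec ℕ 4
        xs = fromList (codeWith c m)
        any : values anyConfig xs ≡ codeWith c m
        any = cong₂ _∷_ (+0+0 _) (cong₂ _∷_ (+0+0 _) (cong₂ (λ i j → i ∷ j ∷ []) (+0+0 _) (+0+0 _)))
          where
          +0+0 : ∀ x → x + 0 + 0 ≡ x
          +0+0 x = trans (+-identityʳ _) (+-identityʳ x)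
        bounded : ∀ i → lookupᵛ xs i < K
        bounded zero = ≤-trans (≤-trans (s≤s (toℕ<n (state c))) Q<V) V≤K
        bounded (suc zero) = ≤-trans (≤-trans (s≤s i≤) w<V) V≤K
        bounded (suc (suc zero)) = ≤-trans (below-bound (tape c) (wpos c) p) V≤K
        bounded (suc (suc (suc zero))) =
          ≤-trans (above-bound (tape c) (wpos c) (≤-trans (m≤n+m m (wpos c)) (≤-reflexive e))) V≤K

      -- A pending nonterminal is expanded before the machine moves on. Each machine step and each
      -- expansion is one step, and the extra one is the halting.
      Leftmost⇒Steps : ∀ {c S r u z e n} → Leftmost r u z → Emits c e n → e ≡ u → ipos c ≤ suc (length w) → Code c S →
        Steps w K schemas (frame S r) (suc (n + z)) []
      Leftmost⇒Steps {S = S} {r} {n = n} (expand {r = r′} {z = z} ρ D) ε e≡ i≤ κ =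
        subst (λ k → Steps w K schemas (frame S r) (suc k) []) (sym (+-suc n z))
          (more (expansion-step i≤ (Emits-wpos ε) κ ρ r′) (Leftmost⇒Steps D ε e≡ i≤ κ))
      Leftmost⇒Steps empty (halted p eq) _ i≤ κ = more (halting-step i≤ p κ eq) stop
      Leftmost⇒Steps (shift D) (halted p eq) () i≤ κ
      Leftmost⇒Steps empty (moved {A = A} p eq ς ε) e≡ i≤ κ
        with Action.emit A | moving-step i≤ p κ eq ς
      ... | nothing | S′ , κ′ , st = more (st _) (Leftmost⇒Steps empty ε e≡ (ipos-successor ς i≤) κ′)
      Leftmost⇒Steps empty (moved {A = A} p eq ς ε) () i≤ κ | just _ | _
      Leftmost⇒Steps (shift D) (moved {A = A} p eq ς ε) e≡ i≤ κ
        with Action.emit A | moving-step i≤ p κ eq ς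
      ... | nothing | S′ , κ′ , st = more (st _) (Leftmost⇒Steps (shift D) ε e≡ (ipos-successor ς i≤) κ′)
      Leftmost⇒Steps (shift D) (moved {A = A} p eq ς ε) refl i≤ κ | just _ | S′ , κ′ , st =
        more (st _) (Leftmost⇒Steps D ε refl (ipos-successor ς i≤) κ′)

      Leftmost⇒Steps-start : ∀ {u z n} → Leftmost [ inj₁ start ] u z → Emits (initConfig M) u n →
        Steps w K schemas [ 0 ] (suc (suc (n + z))) []
      Leftmost⇒Steps-start D ε =
        more (apply initial (0 ∷ 0 ∷ 0 ∷ 0 ∷ []) [] (here refl)
               (λ { zero → 0<K ; (suc zero) → 0<K ; (suc (suc zero)) → 0<K ; (suc (suc (suc zero))) → 0<K })
               refl refl refl)
          (Leftmost⇒Steps D ε refl z≤n initConfig-code)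
        where
        0<K : 0 < K
        0<K = ≤-trans (≤-trans (s≤s z≤n) w<V) V≤K

-- Polynomial bounds and decidability of the word problem

-- A pure power without constant factor, because the numbers named by tuples of k positions are
-- those below `n ^ k`. Constants are absorbed into the exponent, which takes `n` at least 2.
Polynomial : (ℕ → ℕ) → Set
Polynomial f = ∃[ k ] ∀ n → 2 ≤ n → f n ≤ n ^ k

private
  ^-weaken : ∀ {n} → 2 ≤ n → ∀ {j k} → j ≤ k → n ^ j ≤ n ^ k
  ^-weaken {suc n} _ = ^-monoʳ-≤ (suc n)

  n≤2^n : ∀ n → n ≤ 2 ^ n
  n≤2^n n = <⇒≤ (n<2^n n)
    where
    n<2^n : ∀ n → n < 2 ^ n
    n<2^n zero = s≤s z≤n
    n<2^n (suc n) = begin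
      suc (suc n)       ≤⟨ +-mono-≤ (m^n>0 2 n) (n<2^n n) ⟩
      2 ^ n + 2 ^ n     ≤⟨ +-monoʳ-≤ (2 ^ n) (m≤m+n (2 ^ n) 0) ⟩
      2 ^ suc n         ∎
      where open ≤-Reasoning

poly-const : ∀ c → Polynomial (λ _ → c)
poly-const c = c , λ n 2≤n → ≤-trans (n≤2^n c) (^-monoˡ-≤ c 2≤n)

poly-id : Polynomial (λ n → n)
poly-id = 1 , λ n _ → ≤-reflexive (sym (*-identityʳ n))

poly-* : ∀ {f g} → Polynomial f → Polynomial g → Polynomial (λ n → f n * g n)
poly-* (j , p) (k , q) = j + k , λ n 2≤n →
  ≤-trans (*-mono-≤ (p n 2≤n) (q n 2≤n)) (≤-reflexive (sym (^-distribˡ-+-* n j k)))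

poly-+ : ∀ {f g} → Polynomial f → Polynomial g → Polynomial (λ n → f n + g n)
poly-+ {f} {g} (j , p) (k , q) = suc (j + k) , λ n 2≤n → begin
  f n + g n                   ≤⟨ +-mono-≤ (p n 2≤n) (q n 2≤n) ⟩
  n ^ j + n ^ k               ≤⟨ +-mono-≤ (^-weaken 2≤n (m≤m+n j k)) (^-weaken 2≤n (m≤n+m k j)) ⟩
  n ^ (j + k) + n ^ (j + k)   ≤⟨ +-monoʳ-≤ (n ^ (j + k)) (m≤m+n _ 0) ⟩
  2 * n ^ (j + k)             ≤⟨ *-monoˡ-≤ (n ^ (j + k)) 2≤n ⟩
  n ^ suc (j + k)             ∎
  where open ≤-Reasoning

poly-^ : ∀ {f} → Polynomial f → ∀ e → Polynomial (λ n → f n ^ e)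
poly-^ p zero = poly-const 1
poly-^ p (suc e) = poly-* p (poly-^ p e)

2^⌊log₂n⌋≤n : ∀ n → 1 ≤ n → 2 ^ ⌊log₂ n ⌋ ≤ n
2^⌊log₂n⌋≤n = <-rec _ bound
  where
  open ≤-Reasoning
  bound : ∀ n → (∀ {m} → m < n → 1 ≤ m → 2 ^ ⌊log₂ m ⌋ ≤ m) → 1 ≤ n → 2 ^ ⌊log₂ n ⌋ ≤ n
  bound 1 _ _ = ≤-refl
  bound n@(suc (suc m)) rec _ = begin
    2 ^ ⌊log₂ n ⌋              ≡⟨ cong (2 ^_) (m+[n∸m]≡n log-pos) ⟨
    2 * 2 ^ (⌊log₂ n ⌋ ∸ 1)    ≡⟨ cong (λ e → 2 * 2 ^ e) (⌊log₂⌊n/2⌋⌋≡⌊log₂n⌋∸1 n) ⟨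
    2 * 2 ^ ⌊log₂ h ⌋          ≤⟨ *-monoʳ-≤ 2 (rec (⌊n/2⌋<n (suc m)) (s≤s z≤n)) ⟩
    h + (h + 0)                ≡⟨ cong (h +_) (+-identityʳ h) ⟩
    h + h                      ≤⟨ +-monoʳ-≤ h (⌊n/2⌋≤⌈n/2⌉ n) ⟩
    h + ⌈ n /2⌉                ≡⟨ ⌊n/2⌋+⌈n/2⌉≡n n ⟩
    n                          ∎
    where
    h : ℕ
    h = ⌊ n /2⌋
    log-pos : 1 ≤ ⌊log₂ n ⌋
    log-pos = ≤-trans (≤-reflexive (sym (⌊log₂[2^n]⌋≡n 1))) (⌊log₂⌋-mono-≤ {2} {n} (s≤s (s≤s z≤n)))

-- Here logarithmic space enters: `b ≤ 2 ^ b` passes to base 2, and then the logarithm in the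
-- exponent becomes a power of `n`.
poly-exp-log : ∀ b c → Polynomial (λ n → b ^ suc (c * ⌊log₂ n ⌋ + c))
poly-exp-log b c = b * c + b * suc c , λ n 2≤n → begin
  b ^ suc (c * ⌊log₂ n ⌋ + c)                    ≤⟨ ^-monoˡ-≤ (suc (c * ⌊log₂ n ⌋ + c)) (n≤2^n b) ⟩
  (2 ^ b) ^ suc (c * ⌊log₂ n ⌋ + c)              ≡⟨ ^-*-assoc 2 b _ ⟩
  2 ^ (b * suc (c * ⌊log₂ n ⌋ + c))              ≡⟨ cong (2 ^_) (arrange b c ⌊log₂ n ⌋) ⟩
  2 ^ (⌊log₂ n ⌋ * (b * c) + b * suc c)          ≡⟨ ^-distribˡ-+-* 2 (⌊log₂ n ⌋ * (b * c)) (b * suc c) ⟩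
  2 ^ (⌊log₂ n ⌋ * (b * c)) * 2 ^ (b * suc c)    ≡⟨ cong (_* 2 ^ (b * suc c)) (^-*-assoc 2 ⌊log₂ n ⌋ (b * c)) ⟨
  (2 ^ ⌊log₂ n ⌋) ^ (b * c) * 2 ^ (b * suc c)
    ≤⟨ *-mono-≤ (^-monoˡ-≤ (b * c) (2^⌊log₂n⌋≤n n (≤-trans (s≤s z≤n) 2≤n))) (^-monoˡ-≤ (b * suc c) 2≤n) ⟩
  n ^ (b * c) * n ^ (b * suc c)                  ≡⟨ ^-distribˡ-+-* n (b * c) (b * suc c) ⟨
  n ^ (b * c + b * suc c)                        ∎
  where
  open ≤-Reasoning
  arrange : ∀ b c l → b * suc (c * l + c) ≡ l * (b * c) + b * suc c
  arrange = solve-∀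

-- Decidability of evaluation.

private
  nonempty : ∀ {v g} → Evaluates 𝔾 v g → ∃[ x ] ∃[ r ] (v ≡ x ∷ r)
  nonempty (single a) = a , [] , refl
  nonempty (split {v = v} e _) with nonempty e
  ... | x , r , refl = x , r ++ v , refl

Evaluates-single : ∀ {a g} → Evaluates 𝔾 [ a ] g → g ≡ a
Evaluates-single e = go e refl
  where
  go : ∀ {v a g} → Evaluates 𝔾 v g → v ≡ [ a ] → g ≡ a
  go (single a) refl = refl
  go (split e f) eq with nonempty e | nonempty f
  go (split e f) () | _ , [] , refl | _ , _ , refl
  go (split e f) () | _ , _ ∷ _ , refl | _ , _ , refl

-- `x` stays on the left and, as `i` is below the length of `r`, some letter stays on the right;
-- both factors are shorter, which permits recursion on the length.
Split : Letter → List Letter → Letter → Set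
Split x r g = ∃[ i ] ∃[ a ] ∃[ b ]
  (Evaluates 𝔾 (x ∷ take (toℕ {length r} i) r) a × Evaluates 𝔾 (drop (toℕ i) r) b × 𝔾 a b ≡ g)

Evaluates-split : ∀ {v g x r} → Evaluates 𝔾 v g → v ≡ x ∷ r → r ≢ [] → Split x r g
Evaluates-split (single _) refl ne = ⊥-elim (ne refl)
Evaluates-split (split e f) eq ne with nonempty e | nonempty f
Evaluates-split {x = x} (split {a = a} {b} e f) refl ne | _ , u , refl | y , v , refl =
  fromℕ< i< , a , b ,
  subst (λ l → Evaluates 𝔾 (x ∷ l) a) (sym (trans (cong (λ j → take j (u ++ y ∷ v)) (toℕ-fromℕ< i<)) (proj₁ (cut u)))) e ,
  subst (λ l → Evaluates 𝔾 l b) (sym (trans (cong (λ j → drop j (u ++ y ∷ v)) (toℕ-fromℕ< i<)) (proj₂ (cut u)))) f ,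
  refl
  where
  cut : ∀ u → take (length u) (u ++ y ∷ v) ≡ u × drop (length u) (u ++ y ∷ v) ≡ y ∷ v
  cut [] = refl , refl
  cut (z ∷ u) = let p , q = cut u in cong (z ∷_) p , q
  i< : length u < length (u ++ y ∷ v)
  i< = ≤-trans (m<m+n (length u) (s≤s z≤n)) (≤-reflexive (sym (length-++ u)))

-- `L` is a mere predicate; deciding its image words turns its one-letter members into a table that
-- a formula can contain.
Evaluates? : ∀ v g → Dec (Evaluates 𝔾 v g)
Evaluates? v g = go (length v) v ≤-refl g
  where
  go : ∀ n v → length v ≤ n → ∀ g → Dec (Evaluates 𝔾 v g)
  go n [] _ g = no λ e → case (nonempty e)
    where
    case : ∃[ x ] ∃[ r ] ([] ≡ x ∷ r) → ⊥
    case (_ , _ , ())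
  go n (x ∷ []) _ g with x ≟ g
  ... | yes refl = yes (single x)
  ... | no x≢g = no λ e → x≢g (sym (Evaluates-single e))
  go (suc n) (x ∷ r@(_ ∷ _)) (s≤s p) g = map′ to from
    (any? λ i → any? λ a → any? λ b →
      go n (x ∷ take (toℕ i) r) (left-≤ i) a ×-dec go n (drop (toℕ i) r) (right-≤ i) b ×-dec 𝔾 a b ≟ g)
    where
    left-≤ : ∀ (i : Fin (length r)) → suc (length (take (toℕ i) r)) ≤ n
    left-≤ i = ≤-trans (s≤s (≤-trans (≤-reflexive (length-take (toℕ i) r)) (m⊓n≤m (toℕ i) (length r)))) (≤-trans (toℕ<n i) p)
    right-≤ : ∀ (i : Fin (length r)) → length (drop (toℕ i) r) ≤ n
    right-≤ i = ≤-trans (≤-reflexive (length-drop (toℕ i) r)) (≤-trans (m∸n≤m (length r) (toℕ i)) p)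
    to : Split x r g → Evaluates 𝔾 (x ∷ r) g
    to (i , a , b , e , f , refl) = subst (λ l → Evaluates 𝔾 (x ∷ l) (𝔾 a b)) (take++drop≡id (toℕ i) r) (split e f)
    from : Evaluates 𝔾 (x ∷ r) g → Split x r g
    from e = Evaluates-split e refl λ ()

-- The reduction

image : ∀ {s k m} → Word s → (b : ℕ) → Gen s k 0 m → List Letter
image {m = m} w b g = map (eval w b g [] ∘ tabulateᵛ) (tuples (suc b) m)

strip-image : ∀ {s k m} (w : Word s) b (g : Gen s k 0 m) → strip (image w (suc b) g) ≡ output w (suc b) g []
strip-image {m = m} w b g = trans (cong strip (emissions-tuples m (eval w (suc b) g []))) (strip-emissions w b g [])

module _ {s : ℕ} (k : ℕ) (w : Word s) (b : ℕ) (Θ : List (Schema s)) where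
  private
    gen : Gen s k 0 (proj₁ (contentsGen {k = k} Θ))
    gen = proj₂ (contentsGen Θ)

    N : ℕ
    N = suc (suc b) ^ k

    stripped : strip (image w (suc b) gen) ≡ blocks (contents w N Θ)
    stripped = trans (strip-image w b gen) (output-contentsGen {k = k} w (suc b) Θ)

  Evaluates⇒Steps : Evaluates 𝔾 (image w (suc b) gen) pop# → ∃[ n ] Steps w N Θ [ 0 ] n []
  Evaluates⇒Steps e = Selection⇒Steps [ 0 ] (contents-Instance Θ)
    (Run-blocks⇒Selection _ (contents-Content {w = w} {N} Θ) (Run-strip (proj₁ (Evaluates⇒Denotes e) refl)) stripped)

  Steps⇒Evaluates : ∀ {n} → n ≤ N → Steps w N Θ [ 0 ] n [] → Evaluates 𝔾 (image w (suc b) gen) pop#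
  Steps⇒Evaluates n≤N r = Evaluates-strip⁻ _ (subst (λ l → Evaluates 𝔾 l pop#) (sym stripped)
    (Selection⇒Evaluates (contents-Content {w = w} {N} Θ) (Steps⇒Selection n≤N r)))

module Reduction {s d : ℕ} (Γ : CFG d) (M : Transducer s d) (c : ℕ) where
  open Transducer M
  open Tape γ using (base)
  open Machine M
  open Grammar Γ
  open Simulation M Γ

  space : Word s → ℕ
  space w = c * ⌊log₂ length w ⌋ + c

  private
    -- Unfolding the exponents would blow up the normal forms of the powers below.
    abstract
      tapes : Polynomial (λ n → base ^ suc (c * ⌊log₂ n ⌋ + c))
      tapes = poly-exp-log base c

    -- The summands of `values-bound` cover state numbers, input positions with the endmarkers, and
    -- tape numbers; `time` counts codes. The 2 in `time-bound` is for the initial and the halting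
    -- step.
    values-bound time time-bound : ℕ → ℕ
    values-bound n = (Q + (n + 3)) + n ^ proj₁ tapes
    time n = (values-bound n * values-bound n) * (values-bound n * values-bound n)
    time-bound n = values-bound n + (2 + (time n + derivationCost (time n)))

    abstract
      poly-values : Polynomial values-bound
      poly-values = poly-+ {λ n → Q + (n + 3)} {λ n → n ^ proj₁ tapes}
        (poly-+ {λ _ → Q} {λ n → n + 3} (poly-const Q) (poly-+ {λ n → n} {λ _ → 3} poly-id (poly-const 3)))
        (poly-^ {λ n → n} poly-id (proj₁ tapes))

      poly-time : Polynomial time
      poly-time = poly-* {λ n → values-bound n * values-bound n} {λ n → values-bound n * values-bound n} square square
        where
        square : Polynomial (λ n → values-bound n * values-bound n)
        square = poly-* {values-bound} {values-bound} poly-values poly-values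

      poly-derivationCost : Polynomial (derivationCost ∘ time)
      poly-derivationCost = poly-+ {λ _ → nullCost} {treeCost ∘ time} (poly-const nullCost)
        (poly-* {time} {λ n → (suc (CFG.N Γ) * time n + CFG.N Γ) * nodeCost} poly-time
          (poly-* {λ n → suc (CFG.N Γ) * time n + CFG.N Γ} {λ _ → nodeCost}
            (poly-+ {λ n → suc (CFG.N Γ) * time n} {λ _ → CFG.N Γ}
              (poly-* {λ _ → suc (CFG.N Γ)} {time} (poly-const (suc (CFG.N Γ))) poly-time)
              (poly-const (CFG.N Γ)))
            (poly-const nodeCost)))

      poly-bound : Polynomial time-bound
      poly-bound = poly-+ {values-bound} {λ n → 2 + (time n + derivationCost (time n))} poly-values
        (poly-+ {λ _ → 2} {λ n → time n + derivationCost (time n)} (poly-const 2)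
          (poly-+ {time} {derivationCost ∘ time} poly-time poly-derivationCost))

    degree : ℕ
    -- The successor guarantees a digit, as `letterAtF` and `lastAtF` read at least one.
    degree = suc (proj₁ poly-bound)

    bounded : ∀ b → time-bound (suc (suc b)) ≤ suc (suc b) ^ degree
    bounded b = ≤-trans (proj₂ poly-bound (suc (suc b)) (s≤s (s≤s z≤n))) (m≤n*m _ (suc (suc b)))

    derivationCost-mono : ∀ {m n} → m ≤ n → derivationCost m ≤ derivationCost n
    derivationCost-mono p = +-monoʳ-≤ nullCost (*-mono-≤ p
      (*-monoˡ-≤ nodeCost (+-monoˡ-≤ (CFG.N Γ) (*-monoʳ-≤ (suc (CFG.N Γ)) p))))

  arity : ℕ
  arity = proj₁ (contentsGen {k = degree} schemas)

  generator : Gen s degree 0 arity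
  generator = proj₂ (contentsGen {k = degree} schemas)

  -- The base need not be the word length, only at least that and at least 2; so a one-letter word
  -- also has an image, over base 2.
  image-correct : ∀ (w : Word s) b → w ≢ [] → length w ≤ suc (suc b) → ∀ {o} →
    RunsTo M w (space w) (initConfig M) o →
    LangCFG Γ o ⇔ Evaluates 𝔾 (image w (suc b) generator) pop#
  image-correct w b ne w≤n {o} r with Input.RunsTo⇒Emits w (space w) r
  ... | e , m , ε , refl = mk⇔ to from
    where
    n V K : ℕ
    n = suc (suc b)
    V = values-bound n
    K = n ^ degree
    Q<V : Q < V
    Q<V = ≤-trans (≤-trans (≤-reflexive (+-comm 1 Q)) (+-monoʳ-≤ Q (s≤s z≤n))) (m≤m+n _ _)
    w<V : suc (length w) < V
    w<V = begin
      suc (suc (length w)) ≤⟨ s≤s (s≤s w≤n) ⟩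
      suc (suc n)          ≤⟨ n≤1+n _ ⟩
      3 + n                ≡⟨ +-comm 3 n ⟩
      n + 3                ≤⟨ m≤n+m (n + 3) Q ⟩
      Q + (n + 3)          ≤⟨ m≤m+n _ _ ⟩
      V                    ∎
      where open ≤-Reasoning
    B<V : base ^ suc (space w) ≤ V
    B<V = begin
      base ^ suc (space w)              ≤⟨ ^-monoʳ-≤ base (s≤s (+-monoˡ-≤ c (*-monoʳ-≤ c (⌊log₂⌋-mono-≤ w≤n)))) ⟩
      base ^ suc (c * ⌊log₂ n ⌋ + c)    ≤⟨ proj₂ tapes n (s≤s (s≤s z≤n)) ⟩
      n ^ proj₁ tapes                   ≤⟨ m≤n+m _ _ ⟩
      V                                 ∎
      where open ≤-Reasoning
    m≤ : m ≤ time n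
    m≤ = <⇒≤ (Input.Bounds.running-time w (space w) V Q<V w<V B<V ne z≤n ε)
    to : LangCFG Γ e → Evaluates 𝔾 (image w (suc b) generator) pop#
    to D = Steps⇒Evaluates degree w b schemas steps≤
      (Leftmost⇒Steps-start w (space w) V Q<V w<V B<V ne K (≤-trans (m≤m+n V _) (bounded b)) (proj₂ (proj₂ leftmost)) ε)
      where
      leftmost : ∃[ z ] (z ≤ derivationCost (length e) × Leftmost [ inj₁ (CFG.start Γ) ] e z)
      leftmost = Derives⇒Leftmost D
      steps≤ : suc (suc (m + proj₁ leftmost)) ≤ K
      steps≤ = ≤-trans (s≤s (s≤s (+-mono-≤ m≤
          (≤-trans (proj₁ (proj₂ leftmost)) (derivationCost-mono (≤-trans (Input.Emits-length w (space w) ε) m≤))))))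
        (≤-trans (m≤n+m _ V) (bounded b))
    from : Evaluates 𝔾 (image w (suc b) generator) pop# → LangCFG Γ e
    from ev = Leftmost⇒Derives (proj₂ (Steps⇒Leftmost-start w (space w)
      (proj₂ (Evaluates⇒Steps degree w b schemas ev)) ε))

-- One-letter words and the final formulas.

module _ {s K : ℕ} where
  tableF : (Fin s → Bool) → List (Fin s) → Formula s K
  tableF f [] = ¬' trueF
  tableF f (a ∷ as) = ifF (P a tmin) (constF (f a)) (tableF f as)

  sat-table : ∀ x (w : Word s) X f as → x ∈ as → sat (fromList (x ∷ w)) X (tableF f as) ≡ f x
  sat-table x w X f (a ∷ as) p =
    trans (sat-if x w X (P a tmin) (constF (f a)) (tableF f as) refl) (first p)
    where
    first : x ∈ a ∷ as → (if ⌊ x ≟ a ⌋ then sat (fromList (x ∷ w)) X (constF (f a))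
                          else sat (fromList (x ∷ w)) X (tableF f as)) ≡ f x
    first p with x ≟ a
    ... | yes refl = sat-const x w X (f x)
    first (here x≡a) | no x≢a = ⊥-elim (x≢a x≡a)
    first (there p) | no _ = sat-table x w X f as p

WordProblem-singleton : ∀ {g : Letter} {u} → WordProblem 𝔾 ⁅ g ⁆ u ⇔ Evaluates 𝔾 u g
WordProblem-singleton {g} {u} =
  mk⇔ (λ { (h , e , p) → subst (Evaluates 𝔾 u) (x∈⁅y⁆⇒x≡y g p) e }) (λ e → g , e , x∈⁅x⁆ g)

verdict : ∀ {A : Set} → Dec A → Letter
verdict (yes _) = pop#
verdict (no _)  = junk

verdict-correct : ∀ {A C : Set} → C ⇔ A → (a? : Dec A) → C ⇔ Evaluates 𝔾 [ verdict a? ] pop#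
verdict-correct i (yes a) = mk⇔ (λ _ → single pop#) (λ _ → Equivalence.from i a)
verdict-correct i (no ¬a) = mk⇔ (λ c → ⊥-elim (¬a (Equivalence.to i c))) (λ e → ⊥-elim (absurd (Evaluates-single e)))
  where
  absurd : ¬ (_≡_ {A = Letter} pop# junk)
  absurd ()

map-tuples-1 : ∀ m (l : Letter) → map (λ _ → l) (tuples 1 m) ≡ [ l ]
map-tuples-1 m l = trans (emissions-tuples m (λ _ → l)) (constant-emissions m)
  where
  constant-emissions : ∀ m → emissions {1} m (λ _ → l) ≡ [ l ]
  constant-emissions zero = refl
  constant-emissions (suc m) = trans (++-identityʳ _) (constant-emissions m)

module _ {s : ℕ} {L : Language s} (LL : InLOGCFL L) where
  private
    d = proj₁ LL
    Γ = proj₁ (proj₂ LL)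
    M = proj₁ (proj₂ (proj₂ LL))
    c = proj₁ (proj₂ (proj₂ (proj₂ LL)))
    reduction = proj₂ (proj₂ (proj₂ (proj₂ LL)))

  open Reduction Γ M c

  L⇔image : ∀ w b → w ≢ [] → length w ≤ suc (suc b) → L w ⇔ Evaluates 𝔾 (image w (suc b) generator) pop#
  L⇔image w b ne w≤n = mk⇔ (Equivalence.to correct ∘ Equivalence.to L⇔) (Equivalence.from L⇔ ∘ Equivalence.from correct)
    where

    L⇔ = proj₂ (proj₂ (reduction w))
    correct = image-correct w b ne w≤n (proj₁ (proj₂ (reduction w)))

  -- A universe of size 1 leaves room for one letter only, so the words of length 1
  -- are decided beforehand, on the image over a base of size 2.
  shortLetter : Fin s → Letter
  shortLetter a = verdict (Evaluates? (image [ a ] 1 generator) pop#)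

  letterF : Fin 9 → Formula s arity
  letterF j = ifF (tmin ≐ tmax) (tableF (λ a → ⌊ shortLetter a ≟ inject₁ j ⌋) (allFin s))
                                (evalF generator [] (tabulateᵛ id) (inject₁ j))

  private
    sat-letterF-long : ∀ a a′ w X j → sat (fromList (a ∷ a′ ∷ w)) X (letterF j) ≡
      ⌊ eval (a ∷ a′ ∷ w) (suc (length w)) generator [] (tabulateᵛ X) ≟ inject₁ j ⌋
    sat-letterF-long a a′ w X j = trans
      (sat-if a (a′ ∷ w) X (tmin ≐ tmax) (tableF (λ a → ⌊ shortLetter a ≟ inject₁ j ⌋) (allFin s)) (evalF generator [] (tabulateᵛ id) (inject₁ j)) refl)
      (trans (sat-eval a (a′ ∷ w) X generator [] (tabulateᵛ id) (inject₁ j))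
        (cong (λ ds → ⌊ eval (a ∷ a′ ∷ w) (suc (length w)) generator [] ds ≟ inject₁ j ⌋) (sym (tabulateᵛ-∘ X id))))

    sat-letterF-short : ∀ a X j → sat (fromList [ a ]) X (letterF j) ≡ ⌊ shortLetter a ≟ inject₁ j ⌋
    sat-letterF-short a X j = trans
      (sat-if a [] X (tmin ≐ tmax) (tableF (λ a → ⌊ shortLetter a ≟ inject₁ j ⌋) (allFin s)) (evalF generator [] (tabulateᵛ id) (inject₁ j)) refl)
      (sat-table a [] X (λ a → ⌊ shortLetter a ≟ inject₁ j ⌋) (allFin s) (∈-allFin a))

    short : ∀ a → L [ a ] ⇔ Evaluates 𝔾 [ shortLetter a ] pop#
    short a = verdict-correct (L⇔image [ a ] 0 (λ ()) (s≤s z≤n)) (Evaluates? (image [ a ] 1 generator) pop#)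

  InLOGCFL⇒InQGFO : InQGFO 𝔾 L
  InLOGCFL⇒InQGFO = ⁅ pop# ⁆ , arity , letterF , correct
    where
    via : ∀ {A : Set} {g : Letter} {u v} → A ⇔ Evaluates 𝔾 v g → u ≡ v → A ⇔ WordProblem 𝔾 ⁅ g ⁆ u
    via i refl = mk⇔ (Equivalence.from WordProblem-singleton ∘ Equivalence.to i)
                     (Equivalence.from i ∘ Equivalence.to WordProblem-singleton)
    correct : ∀ a w → L (a ∷ w) ⇔ QHolds (WordProblem 𝔾 ⁅ pop# ⁆) letterF (length w) (fromList (a ∷ w))
    correct a [] = via (short a) (trans
      (map-cong (λ X → letterOf-unique (fromList [ a ]) letterF X (shortLetter a) (sat-letterF-short a X)) (tuples 1 arity))
      (map-tuples-1 arity (shortLetter a)))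
    correct a (a′ ∷ w) = via (L⇔image (a ∷ a′ ∷ w) (length w) (λ ()) ≤-refl)
      (map-cong (λ X → letterOf-unique (fromList (a ∷ a′ ∷ w)) letterF X _ (sat-letterF-long a a′ w X))
        (tuples (suc (suc (length w))) arity))

theorem12 : Σ[ m ∈ ℕ ] Σ[ G ∈ Groupoid m ]
    (∀ (s : ℕ) (L : Language s) → InLOGCFL L → InQGFO G L)
theorem12 = 9 , 𝔾 , λ s L → InLOGCFL⇒InQGFO
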